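{- For every integer $k\ge 4$, $$s(k)\le \left\lceil \tfrac{5}{2}k\right\rceil-3.$$
   Context: The off-diagonal Ramsey number $r_k(s,n)$ is the minimum $N$ such that every red-blue coloring of the $k$-element subsets of an $N$-element set contains a red $s$-set (a set of size $s$ all of whose $k$-element subsets are red) or a blue $n$-set (a set of size $n$ all of whose $k$-element subsets are blue). The tower function $t_k(x)$ is defined by $t_1(x)=x$ and $t_{i+1}(x)=2^{t_i(x)}$. For $k\ge 4$, $s(k)$ denotes the minimum $s$ for which $r_k(s,n)$ grows at least as a tower function of height $k-1$ in $n$, i.e. for which there is a constant $c>0$ (which may depend on $k$ and $s$) such that $r_k(s,n)\ge t_{k-1}(cn)$ for all sufficiently large $n$. -}

module Defs where

open import Algebra.Definitions.RawSemiring using (_^_)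
open import Data.Empty using (⊥-elim)
open import Data.Fin using (Fin; zero; suc) renaming (_≟_ to _≟ᶠ_)
open import Data.Fin.Subset using (Subset; Side; inside; outside; ∣_∣; _∈_; _⊆_; ⊤)
  renaming (⊥ to ∅)
open import Data.Fin.Subset.Properties
  using (anySubset?; _⊆?_; _∈?_; ⊆-trans; ∣⊤∣≡n; ∣⊥∣≡0; ⊆⊤; ∉⊥)
open import Data.Integer using (ℤ; +_; -[1+_])
open import Data.Nat using (ℕ; zero; suc; _≤_; z≤n; s≤s; _+_; _∸_)
import Data.Nat.Properties as ℕ
open import Data.Nat.Induction using (<-rec)
open import Data.Product using (∃; ∃-syntax; _×_; _,_; proj₁; proj₂)
open import Data.Rational as ℚ using (ℚ; 0ℚ; ½; ↥_; ↧ₙ_)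
open import Data.Sum using (_⊎_; inj₁; inj₂)
import Data.Sum as Sum
open import Data.Vec using ([]; _∷_; _[_]≔_; lookup; here; there)
open import Data.Vec.Properties
  using ([]≔-idempotent; []≔-lookup; []=⇒lookup; lookup⇒[]=;
         lookup∘update; lookup∘update′)
open import Function using (_∘_)
open import Relation.Binary.PropositionalEquality
  using (_≡_; _≢_; refl; sym; trans; cong; subst)
open import Relation.Nullary using (¬_; Dec; yes; no; contradiction; ¬?; _×-dec_; _⊎-dec_)
import Relation.Nullary.Decidable as Dec
open import Relation.Unary using (Decidable)

------------------------------------------------------------------------
-- Least elements

IsLeast : (ℕ → Set) → ℕ → Set
IsLeast P m = P m × (∀ m′ → P m′ → m ≤ m′)

least : ∀ {P : ℕ → Set} → Decidable P → ∀ m → P m → ∃ (IsLeast P)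
least P? zero    p = zero , p , λ _ _ → z≤n
least P? (suc m) p with P? zero
... | yes p₀ = zero , p₀ , λ _ _ → z≤n
... | no ¬p₀ with least (P? ∘ suc) m p
...   | l , pl , l≤ = suc l , pl , λ { zero p₀ → contradiction p₀ ¬p₀
                                     ; (suc m′) q → s≤s (l≤ m′ q) }

-- Without decidability, a nonempty P still cannot fail to have a least element.
¬¬least : ∀ {P : ℕ → Set} → ∃ P → ¬ ¬ ∃ (IsLeast P)
¬¬least {P} (m , p) noLeast = none m p
  where
  none : ∀ m → ¬ P m
  none = <-rec (λ m → ¬ P m) λ m below pm → noLeast (m , pm , λ m′ pm′ →
    ℕ.≮⇒≥ λ m′<m → below m′<m pm′)

------------------------------------------------------------------------
-- Colourings

data Colour : Set where
  red blue : Colour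

Edge : ℕ → ℕ → Set
Edge k N = ∃[ e ] (∣_∣ {N} e ≡ k)

Colouring : ℕ → ℕ → Set
Colouring k N = Edge k N → Colour

Monochromatic : ∀ {k N} → Colouring k N → Colour → Subset N → Set
Monochromatic χ c S = ∀ e → proj₁ e ⊆ S → χ e ≡ c

Arrows : ℕ → ℕ → ℕ → ℕ → Set
Arrows k s n N = ∀ (χ : Colouring k N) →
    (∃[ S ] ∣ S ∣ ≡ s × Monochromatic χ red S)
  ⊎ (∃[ S ] ∣ S ∣ ≡ n × Monochromatic χ blue S)

------------------------------------------------------------------------
-- Ramsey's theorem, which makes the Ramsey number a function.  Here it is
-- convenient to colour all subsets and only look at those of size k.

module Ramsey where

  Mono : ∀ {N} → ℕ → (Subset N → Colour) → Colour → Subset N → Set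
  Mono k f c S = ∀ e → ∣ e ∣ ≡ k → e ⊆ S → f e ≡ c

  Found : ∀ {N} → ℕ → (Subset N → Colour) → Colour → ℕ → Subset N → Set
  Found k f c m S = ∃[ T ] T ⊆ S × ∣ T ∣ ≡ m × Mono k f c T

  Found-⊆ : ∀ {N k f c m} {S T : Subset N} → S ⊆ T → Found k f c m S → Found k f c m T
  Found-⊆ S⊆T (U , U⊆S , rest) = U , ⊆-trans U⊆S S⊆T , rest

  ∣insert∣ : ∀ {N} (S : Subset N) x → lookup S x ≡ outside → ∣ S [ x ]≔ inside ∣ ≡ suc ∣ S ∣
  ∣insert∣ (outside ∷ S) zero    eq = refl
  ∣insert∣ (inside  ∷ S) (suc x) eq = cong suc (∣insert∣ S x eq)
  ∣insert∣ (outside ∷ S) (suc x) eq = ∣insert∣ S x eq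

  reinsert : ∀ {N} (S : Subset N) x → x ∈ S → (S [ x ]≔ outside) [ x ]≔ inside ≡ S
  reinsert S x x∈S = trans ([]≔-idempotent S x)
    (trans (cong (S [ x ]≔_) (sym ([]=⇒lookup x∈S))) ([]≔-lookup S x))

  ∣remove∣ : ∀ {N} (S : Subset N) x → x ∈ S → ∣ S ∣ ≡ suc ∣ S [ x ]≔ outside ∣
  ∣remove∣ S x x∈S = trans (cong ∣_∣ (sym (reinsert S x x∈S)))
    (∣insert∣ (S [ x ]≔ outside) x (lookup∘update x S outside))

  remove-∉ : ∀ {N} (S : Subset N) x → ¬ x ∈ S [ x ]≔ outside
  remove-∉ S x x∈ with trans (sym (lookup∘update x S outside)) ([]=⇒lookup x∈)
  ... | ()

  update-≢ : ∀ {N} (S : Subset N) {x y} (b : Side) → y ≢ x → y ∈ S [ x ]≔ b → y ∈ S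
  update-≢ S {x} {y} b y≢x y∈ =
    lookup⇒[]= y S (trans (sym (lookup∘update′ y≢x S b)) ([]=⇒lookup y∈))

  remove-⊆ : ∀ {N} (S : Subset N) x → S [ x ]≔ outside ⊆ S
  remove-⊆ S x {y} y∈ with y ≟ᶠ x
  ... | yes refl = ⊥-elim (remove-∉ S x y∈)
  ... | no y≢x   = update-≢ S outside y≢x y∈

  choose : ∀ {N} (S : Subset N) {m} → suc m ≤ ∣ S ∣ → ∃[ x ] x ∈ S
  choose (inside  ∷ S) _ = zero , here
  choose (outside ∷ S) p with choose S p
  ... | x , x∈S = suc x , there x∈S

  shrink : ∀ {N} (S : Subset N) m → m ≤ ∣ S ∣ → ∃[ T ] T ⊆ S × ∣ T ∣ ≡ m
  shrink {N} S zero _ = ∅ , (λ x∈∅ → ⊥-elim (∉⊥ x∈∅)) , ∣⊥∣≡0 N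
  shrink S (suc m) m<∣S∣ with choose S m<∣S∣
  ... | x , x∈S
    with shrink (S [ x ]≔ outside) m (ℕ.≤-pred (subst (suc m ≤_) (∣remove∣ S x x∈S) m<∣S∣))
  ... | T , T⊆ , ∣T∣≡m = T [ x ]≔ inside , T′⊆S , trans (∣insert∣ T x x∉T) (cong suc ∣T∣≡m)
    where
    x∉T : lookup T x ≡ outside
    x∉T with lookup T x in eq
    ... | outside = refl
    ... | inside  = ⊥-elim (remove-∉ S x (T⊆ (lookup⇒[]= x T eq)))
    T′⊆S : T [ x ]≔ inside ⊆ S
    T′⊆S {y} y∈ with y ≟ᶠ x
    ... | yes refl = x∈S
    ... | no y≢x   = remove-⊆ S x (T⊆ (update-≢ T inside y≢x y∈))

  ∣e∣≡0⇒∅ : ∀ {N} (e : Subset N) → ∣ e ∣ ≡ 0 → e ≡ ∅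
  ∣e∣≡0⇒∅ []            _ = refl
  ∣e∣≡0⇒∅ (outside ∷ e) p = cong (outside ∷_) (∣e∣≡0⇒∅ e p)

  Found-zero : ∀ {N} k f c (S : Subset N) → Found (suc k) f c 0 S
  Found-zero {N} k f c S = ∅ , (λ x∈∅ → ⊥-elim (∉⊥ x∈∅)) , ∣⊥∣≡0 N , λ e ∣e∣≡ e⊆∅ →
    ⊥-elim (∉⊥ (e⊆∅ (proj₂ (choose e (ℕ.≤-reflexive (sym ∣e∣≡))))))

  link : ∀ {N} → Fin N → (Subset N → Colour) → Subset N → Colour
  link x f e = f (e [ x ]≔ inside)

  extend : ∀ {N k f c m} (S : Subset N) {x T} → x ∈ S → T ⊆ S [ x ]≔ outside →
           Mono k (link x f) c T → Found (suc k) f c m T → Found (suc k) f c (suc m) S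
  extend {k = k} {f} {c} S {x} {T} x∈S T⊆ monoT (U , U⊆T , ∣U∣≡m , monoU) =
    U [ x ]≔ inside , U′⊆S , trans (∣insert∣ U x x∉U) (cong suc ∣U∣≡m) , mono
    where
    x∉U : lookup U x ≡ outside
    x∉U with lookup U x in eq
    ... | outside = refl
    ... | inside  = ⊥-elim (remove-∉ S x (T⊆ (U⊆T (lookup⇒[]= x U eq))))
    U′⊆S : U [ x ]≔ inside ⊆ S
    U′⊆S {y} y∈ with y ≟ᶠ x
    ... | yes refl = x∈S
    ... | no y≢x   = remove-⊆ S x (T⊆ (U⊆T (update-≢ U inside y≢x y∈)))
    mono : Mono (suc k) f c (U [ x ]≔ inside)
    mono e ∣e∣≡ e⊆ with x ∈? e
    ... | no x∉e = monoU e ∣e∣≡ e⊆U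
      where
      e⊆U : e ⊆ U
      e⊆U {y} y∈e with y ≟ᶠ x
      ... | yes refl = ⊥-elim (x∉e y∈e)
      ... | no y≢x   = update-≢ U inside y≢x (e⊆ y∈e)
    ... | yes x∈e = trans (cong f (sym (reinsert e x x∈e)))
      (monoT e′ (ℕ.suc-injective (trans (sym (∣remove∣ e x x∈e)) ∣e∣≡)) e′⊆T)
      where
      e′ = e [ x ]≔ outside
      e′⊆T : e′ ⊆ T
      e′⊆T {y} y∈e′ with y ≟ᶠ x
      ... | yes refl = ⊥-elim (remove-∉ e x y∈e′)
      ... | no y≢x   = U⊆T (update-≢ U inside y≢x (e⊆ (remove-⊆ e x y∈e′)))

  bound : ℕ → ℕ → ℕ → ℕ
  bound zero    s       n       = s + n
  bound (suc k) zero    n       = 0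
  bound (suc k) (suc s) zero    = 0
  bound (suc k) (suc s) (suc n) =
    suc (bound k (bound (suc k) s (suc n)) (bound (suc k) (suc s) n))

  Works : ℕ → ℕ → ℕ → ℕ → Set
  Works k s n m = ∀ {N} (f : Subset N → Colour) S → m ≤ ∣ S ∣ →
                  Found k f red s S ⊎ Found k f blue n S

  ramseyStep : ∀ {k s n a b N} (f : Subset N → Colour) S → ∀ {m} → suc m ≤ ∣ S ∣ →
    Works k a b m → Works (suc k) s (suc n) a → Works (suc k) (suc s) n b →
    Found (suc k) f red (suc s) S ⊎ Found (suc k) f blue (suc n) S
  ramseyStep f S big works worksRed worksBlue with choose S big
  ... | x , x∈S
    with works (link x f) (S [ x ]≔ outside)
           (ℕ.≤-pred (subst (_ ≤_) (∣remove∣ S x x∈S) big))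
  ... | inj₁ (T , T⊆ , ∣T∣≡ , mono) = Sum.map
          (extend S x∈S T⊆ mono) (Found-⊆ (⊆-trans T⊆ (remove-⊆ S x)))
          (worksRed f T (ℕ.≤-reflexive (sym ∣T∣≡)))
  ... | inj₂ (T , T⊆ , ∣T∣≡ , mono) = Sum.map
          (Found-⊆ (⊆-trans T⊆ (remove-⊆ S x))) (extend S x∈S T⊆ mono)
          (worksBlue f T (ℕ.≤-reflexive (sym ∣T∣≡)))

  ramsey : ∀ k s n → Works k s n (bound k s n)
  ramsey zero s n f S big with f ∅ in eq
  ... | red  with shrink S s (ℕ.m+n≤o⇒m≤o s big)
  ...   | T , T⊆S , ∣T∣≡ =
    inj₁ (T , T⊆S , ∣T∣≡ , λ e ∣e∣≡0 _ → trans (cong f (∣e∣≡0⇒∅ e ∣e∣≡0)) eq)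
  ramsey zero s n f S big | blue with shrink S n (ℕ.m+n≤o⇒n≤o s big)
  ...   | T , T⊆S , ∣T∣≡ =
    inj₂ (T , T⊆S , ∣T∣≡ , λ e ∣e∣≡0 _ → trans (cong f (∣e∣≡0⇒∅ e ∣e∣≡0)) eq)
  ramsey (suc k) zero    n       f S big = inj₁ (Found-zero k f red S)
  ramsey (suc k) (suc s) zero    f S big = inj₂ (Found-zero k f blue S)
  ramsey (suc k) (suc s) (suc n) f S big = ramseyStep f S big
    (ramsey k (bound (suc k) s (suc n)) (bound (suc k) (suc s) n))
    (ramsey (suc k) s (suc n))
    (ramsey (suc k) (suc s) n)

  Arrows′ : ℕ → ℕ → ℕ → ℕ → Set
  Arrows′ k s n N = ∀ (f : Subset N → Colour) → Found k f red s ⊤ ⊎ Found k f blue n ⊤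

  extendColouring : ∀ {k N} → Colouring k N → Subset N → Colour
  extendColouring {k} χ e with ∣ e ∣ ℕ.≟ k
  ... | yes p = χ (e , p)
  ... | no _  = red

  extendColouring-≡ : ∀ {k N} (χ : Colouring k N) e p → extendColouring χ e ≡ χ (e , p)
  extendColouring-≡ {k} χ e p with ∣ e ∣ ℕ.≟ k
  ... | yes q = cong (λ r → χ (e , r)) (ℕ.≡-irrelevant q p)
  ... | no ¬p = contradiction p ¬p

  from′ : ∀ {k s n N} → Arrows′ k s n N → Arrows k s n N
  from′ {k} arr χ = Sum.map conv conv (arr (extendColouring χ))
    where
    conv : ∀ {c m} → Found k (extendColouring χ) c m ⊤ →
           ∃[ S ] ∣ S ∣ ≡ m × Monochromatic χ c S
    conv (S , _ , ∣S∣≡ , mono) = S , ∣S∣≡ , λ { (e , p) e⊆S →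
      trans (sym (extendColouring-≡ χ e p)) (mono e p e⊆S) }

  to′ : ∀ {k s n N} → Arrows k s n N → Arrows′ k s n N
  to′ {k} {N = N} arr f = Sum.map conv conv (arr χ)
    where
    χ : Colouring k N
    χ (e , _) = f e
    conv : ∀ {c m} → ∃[ S ] ∣ S ∣ ≡ m × Monochromatic χ c S → Found k f c m ⊤
    conv (S , ∣S∣≡ , mono) = S , ⊆⊤ , ∣S∣≡ , λ e p e⊆S → mono (e , p) e⊆S

  _≟ᶜ_ : (c d : Colour) → Dec (c ≡ d)
  red  ≟ᶜ red  = yes refl
  red  ≟ᶜ blue = no λ ()
  blue ≟ᶜ red  = no λ ()
  blue ≟ᶜ blue = yes refl

  Mono? : ∀ {N} k f c (S : Subset N) → Dec (Mono k f c S)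
  Mono? k f c S with anySubset? (λ e → (∣ e ∣ ℕ.≟ k) ×-dec ((e ⊆? S) ×-dec ¬? (f e ≟ᶜ c)))
  ... | yes (e , p , e⊆S , fe≢c) = no λ mono → fe≢c (mono e p e⊆S)
  ... | no none = yes λ e p e⊆S → Dec.decidable-stable (f e ≟ᶜ c)
                    λ fe≢c → none (e , p , e⊆S , fe≢c)

  Found? : ∀ {N} k f c m (S : Subset N) → Dec (Found k f c m S)
  Found? k f c m S =
    anySubset? λ T → (T ⊆? S) ×-dec ((∣ T ∣ ℕ.≟ m) ×-dec Mono? k f c T)

  -- There is no function extensionality, so the predicate must respect
  -- pointwise equality of colourings.
  allColourings? : ∀ N (Q : (Subset N → Colour) → Set) →
    (∀ {f g} → (∀ e → f e ≡ g e) → Q f → Q g) → Decidable Q → Dec (∀ f → Q f)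
  allColourings? zero Q resp Q? with Q? (λ _ → red) | Q? (λ _ → blue)
  ... | no ¬q | _     = no λ all → ¬q (all _)
  ... | yes _ | no ¬q = no λ all → ¬q (all _)
  ... | yes r | yes b = yes every
    where
    every : ∀ f → Q f
    every f with f [] in eq
    ... | red  = resp (λ { [] → sym eq }) r
    ... | blue = resp (λ { [] → sym eq }) b
  allColourings? (suc N) Q resp Q? = Dec.map′
    (λ all f → resp (λ { (inside ∷ e) → refl ; (outside ∷ e) → refl })
                 (all (f ∘ (inside ∷_)) (f ∘ (outside ∷_))))
    (λ all g h → all (merge g h))
    (allColourings? N (λ g → ∀ h → Q (merge g h))
      (λ g≗g′ q h → resp (λ { (inside ∷ e) → g≗g′ e ; (outside ∷ e) → refl }) (q h))
      λ g → allColourings? N (λ h → Q (merge g h))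
        (λ h≗h′ → resp (λ { (inside ∷ e) → refl ; (outside ∷ e) → h≗h′ e }))
        λ h → Q? (merge g h))
    where
    merge : (g h : Subset N → Colour) → Subset (suc N) → Colour
    merge g h (inside  ∷ e) = g e
    merge g h (outside ∷ e) = h e

  Found-resp : ∀ {N k c m} {S : Subset N} {f g} → (∀ e → f e ≡ g e) →
               Found k f c m S → Found k g c m S
  Found-resp f≗g (T , T⊆S , ∣T∣≡ , mono) =
    T , T⊆S , ∣T∣≡ , λ e p e⊆T → trans (sym (f≗g e)) (mono e p e⊆T)

  Arrows? : ∀ k s n → Decidable (Arrows k s n)
  Arrows? k s n N = Dec.map′ from′ to′ (allColourings? N _
    (λ f≗g → Sum.map (Found-resp f≗g) (Found-resp f≗g))
    λ f → Found? k f red s ⊤ ⊎-dec Found? k f blue n ⊤)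

  leastArrows : ∀ k s n → ∃ (IsLeast (Arrows k s n))
  leastArrows k s n = least (Arrows? k s n) N
    (from′ λ f → ramsey k s n f ⊤ (ℕ.≤-reflexive (sym (∣⊤∣≡n N))))
    where N = bound k s n

-- The Ramsey number r_k(s,n).  It is opaque so that it is never evaluated;
-- r-isLeast characterises it.
opaque
  r : ℕ → ℕ → ℕ → ℕ
  r k s n = proj₁ (Ramsey.leastArrows k s n)

  r-isLeast : ∀ k s n → IsLeast (Arrows k s n) (r k s n)
  r-isLeast k s n = proj₂ (Ramsey.leastArrows k s n)

------------------------------------------------------------------------
-- The tower function at a real argument.  A real number x is represented by
-- its open lower cut { q ∈ ℚ : q < x }.

Cut : Set₁
Cut = ℚ → Set

fromℕ : ℕ → ℚ
fromℕ n = + n ℚ./ 1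

⟦_⟧ : ℚ → Cut
⟦ x ⟧ q = q ℚ.< x

_^ℚ_ : ℚ → ℕ → ℚ
_^ℚ_ = _^_ ℚ.+-*-rawSemiring

2^_ : ℤ → ℚ
2^ (+ n)    = fromℕ 2 ^ℚ n
2^ -[1+ n ] = ½ ^ℚ suc n

-- q < 2ᵖ for rational p = a / b with b > 0: if q ≥ 0 this means qᵇ < 2ᵃ.
_<2^_ : ℚ → ℚ → Set
q <2^ p = q ℚ.< 0ℚ ⊎ (q ^ℚ (↧ₙ p)) ℚ.< (2^ (↥ p))

-- By continuity and monotonicity, q < 2ˣ iff q < 2ᵖ for some rational p < x.
exp₂ : Cut → Cut
exp₂ X q = ∃[ p ] X p × q <2^ p

-- t i x is t_i(x) for i ≥ 1; the value at i = 0 is junk.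
t : ℕ → Cut → Cut
t 0             x = x
t 1             x = x
t (suc (suc i)) x = exp₂ (t (suc i) x)

_≤ᶜ_ : Cut → ℕ → Set
X ≤ᶜ m = ∀ q → X q → q ℚ.≤ fromℕ m

------------------------------------------------------------------------
-- The threshold s(k)

-- A real constant c > 0 may always be decreased to a rational one, as t_i is
-- increasing, so c ranges over ℚ.
TowerGrowth : ℕ → ℕ → Set
TowerGrowth k s = ∃[ c ] (0ℚ ℚ.< c × (∃[ n₀ ] ∀ n → n₀ ≤ n →
  t (k ∸ 1) ⟦ c ℚ.* fromℕ n ⟧ ≤ᶜ r k s n))

-- "s = s(k)".  This is a relation because TowerGrowth k is not decidable, so
-- that its least element exists only classically (see ¬¬least).
Is-s : ℕ → ℕ → Set
Is-s k s = IsLeast (TowerGrowth k) s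

{-# OPTIONS --safe #-}
module Submission where

-- It suffices to take s = 2k - 1, which is at most ⌈5k/2⌉ - 3.
--
-- For k = 3, label the pairs of numbers below 2ᵐ by booleans f and colour
-- a > b > c red iff f(a,b) ≠ f(a,c).  No four points span only red triples, as
-- three booleans are not pairwise distinct.  On a blue set f(a,b) depends only
-- on a, so a union bound gives an f without blue sets of size 2m + 4.
--
-- A colouring φ of k-sets below N is stepped up to (k+1)-sets below 2ᴺ as by
-- Erdős and Hajnal.  A set has a sequence of k highest differing binary digits
-- of neighbours.  If this sequence is monotone, apply φ to it; otherwise colour
-- it red iff its second term is a peak.  A blue set has no peaks except near its
-- end, so its digits fall and then rise, whence a monotone run of about half the
-- length.  If k ≥ 4, then for a red set the digits rise throughout or fall from
-- the second one on: a valley in second place or a peak in third place would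
-- make some (k+1)-subset blue.  So s grows by only 2.  For k = 3 it grows from 4 to 7.

open import Defs
open import Data.Bool as Bool using (Bool; true; false)
open import Data.Empty using (⊥)
open import Data.Fin.Subset using (Subset; inside; outside; ∣_∣; _⊆_) renaming (⊥ to ∅)
open import Data.Fin.Subset.Properties using (s⊆s; out⊆; ∣⊥∣≡0)
open import Data.Integer as ℤ using (-[1+_]) renaming (+_ to pos)
import Data.Integer.Properties as ℤ
open import Data.List using (List; []; _∷_; length; take; drop; reverse; _ʳ++_; map; _++_)
open import Data.List.Membership.Propositional using (_∈_)
open import Data.List.Membership.Propositional.Properties using (∈-map⁺; ∈-++⁺ˡ; ∈-++⁺ʳ)
open import Data.List.Properties
  using (length-reverse; reverse-involutive; length-++; length-map; length-take; take-all)
open import Data.List.Relation.Binary.Sublist.Propositional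
  using ([]; _∷_; _∷ʳ_; minimum; from∈)
  renaming (_⊆_ to _⊑_; ⊆-refl to ⊑-refl; ⊆-trans to ⊑-trans; lookup to ⊑-lookup)
open import Data.List.Relation.Binary.Sublist.Propositional.Properties
  using (reverse⁺) renaming (All-resp-⊆ to All-⊑; take-⊆ to take-⊑; drop-⊆ to drop-⊑)
open import Data.List.Relation.Unary.All as All using (All; []; _∷_)
import Data.List.Relation.Unary.All.Properties as All
open import Data.List.Relation.Unary.AllPairs using (AllPairs; []; _∷_; allPairs?)
import Data.List.Relation.Unary.AllPairs.Properties as AllPairs
open import Data.List.Relation.Unary.Any using (here; there)
open import Data.List.Relation.Unary.Linked as Linked using (Linked; []; [-]; _∷_)
open import Data.Maybe using (Maybe; just; nothing)
import Data.Nat.Coprimality as Coprime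
open import Data.Nat hiding (_≟_)
open import Data.Nat.DivMod using (_/_; _%_; m*n/n≡m; /-monoˡ-≤; m≡m%n+[m/n]*n; m%n<n)
open import Data.Nat.ListAction using (sum)
open import Data.Nat.Properties
open import Data.Nat.Tactic.RingSolver using (solve-∀)
open import Data.Product using (∃-syntax; _×_; _,_; proj₁; proj₂)
open import Data.Rational as ℚ using (ℚ; mkℚ; 0ℚ; 1ℚ; ½; ↥_; ↧ₙ_; *≤*; toℚᵘ)
import Data.Rational.Properties as ℚ
open import Data.Rational.Unnormalised as ℚᵘ using (mkℚᵘ)
import Data.Rational.Unnormalised.Properties as ℚᵘ
open import Data.Sum using (_⊎_; inj₁; inj₂)
open import Data.Unit using (⊤; tt)
open import Data.Vec as Vec using (Vec; []; _∷_)
open import Function using (_∘_)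
open import Level using (0ℓ)
open import Relation.Binary using (Rel; Transitive; tri<; tri≈; tri>)
open import Relation.Binary.PropositionalEquality
open import Relation.Nullary using (¬_; yes; no; contradiction)

-- Colourings of finite sets of naturals

-- A set is represented by the list of its elements in descending order.
data Below : ℕ → List ℕ → Set where
  []  : ∀ {m} → Below m []
  _∷_ : ∀ {m x xs} → x < m → Below x xs → Below m (x ∷ xs)

Below-weaken : ∀ {m n xs} → m ≤ n → Below m xs → Below n xs
Below-weaken m≤n []       = []
Below-weaken m≤n (p ∷ ps) = <-≤-trans p m≤n ∷ ps

Below-⊑ : ∀ {m xs ys} → xs ⊑ ys → Below m ys → Below m xs
Below-⊑ []         []       = []
Below-⊑ (y ∷ʳ σ)   (p ∷ ps) = Below-weaken (<⇒≤ p) (Below-⊑ σ ps)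
Below-⊑ (refl ∷ σ) (p ∷ ps) = p ∷ Below-⊑ σ ps

Below⇒All : ∀ {m xs} → Below m xs → All (_< m) xs
Below⇒All []       = []
Below⇒All (p ∷ ps) = p ∷ All.map (λ q → <-trans q p) (Below⇒All ps)

Mono : (List ℕ → Colour) → ℕ → Colour → List ℕ → Set
Mono f k c xs = ∀ ys → ys ⊑ xs → length ys ≡ k → f ys ≡ c

NoMono : (List ℕ → Colour) → ℕ → Colour → ℕ → ℕ → Set
NoMono f k c m N = ∀ xs → Below N xs → m ≤ length xs → ¬ Mono f k c xs

-- A witness that N points are too few for the Ramsey property. The colouring is defined on all
-- lists, so no size proofs accompany its argument.
Avoids : ℕ → ℕ → ℕ → ℕ → Set
Avoids k s n N = ∃[ f ] NoMono f k red s N × NoMono f k blue n N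

Mono-⊑ : ∀ {f k c xs ys} → xs ⊑ ys → Mono f k c ys → Mono f k c xs
Mono-⊑ σ mono zs τ = mono zs (⊑-trans τ σ)

-- Highest differing binary digits

-- For distinct a, b < 2ᴺ, the position of the highest digit in which they differ.
δ : ℕ → ℕ → ℕ → ℕ
δ zero    a b = 0
δ (suc N) a b with ⌊ a /2⌋ ≟ ⌊ b /2⌋
... | yes _ = 0
... | no  _ = suc (δ N ⌊ a /2⌋ ⌊ b /2⌋)

⌊/2⌋-<-2^ : ∀ {N a} → a < 2 ^ suc N → ⌊ a /2⌋ < 2 ^ N
⌊/2⌋-<-2^ {N} {a} a< = *-cancelˡ-< 2 _ _ (≤-<-trans 2h≤a a<)
  where
  2h≤a : 2 * ⌊ a /2⌋ ≤ a
  2h≤a = begin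
    2 * ⌊ a /2⌋                ≡⟨ cong (⌊ a /2⌋ +_) (+-identityʳ _) ⟩
    ⌊ a /2⌋ + ⌊ a /2⌋          ≤⟨ +-monoʳ-≤ ⌊ a /2⌋ (⌊n/2⌋≤⌈n/2⌉ a) ⟩
    ⌊ a /2⌋ + ⌈ a /2⌉          ≡⟨ ⌊n/2⌋+⌈n/2⌉≡n a ⟩
    a                          ∎
    where open ≤-Reasoning

δ< : ∀ {N a b} → b < a → a < 2 ^ N → δ N a b < N
δ< {zero}  b<a (s≤s z≤n) with () ← b<a
δ< {suc N} {a} {b} b<a a<2^N with ⌊ a /2⌋ ≟ ⌊ b /2⌋
... | yes _ = z<s
... | no ≢  = s<s (δ< (≤∧≢⇒< (⌊n/2⌋-mono (<⇒≤ b<a)) (≢ ∘ sym)) (⌊/2⌋-<-2^ {N} a<2^N))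

-- The strict ultrametric law. For a > b > c the two inner values cannot tie: b has digit 0 at the
-- top place where a and b differ, but 1 at the top place where b and c differ.
Ultra : ℕ → ℕ → ℕ → Set
Ultra x y z = (x < y × z ≡ y) ⊎ (y < x × z ≡ x)

-- Induction on the number of digits: if a and b agree after deleting the last
-- digit then so cannot b and c, since three distinct numbers do not share
-- all but the last digit.
δ-ultra : ∀ {N a b c} → c < b → b < a → a < 2 ^ N →
          Ultra (δ N a b) (δ N b c) (δ N a c)
δ-ultra {zero} c<b b<a (s≤s z≤n) with () ← b<a
δ-ultra {suc N} {a} {b} {c} c<b b<a a<2^N
  with ⌊ a /2⌋ ≟ ⌊ b /2⌋ | ⌊ b /2⌋ ≟ ⌊ c /2⌋ | ⌊ a /2⌋ ≟ ⌊ c /2⌋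
... | yes p | yes q | _     =
  contradiction (sym (trans p q)) (<⇒≢ (⌊n/2⌋-mono {2 + c} (≤-trans (s≤s c<b) b<a)))
... | yes p | no ¬q | yes w = contradiction (trans (sym p) w) ¬q
... | yes p | no ¬q | no _  = inj₁ (z<s , cong (λ h → suc (δ N h ⌊ c /2⌋)) p)
... | no ¬p | yes q | yes w = contradiction (trans w (sym q)) ¬p
... | no ¬p | yes q | no _  = inj₂ (z<s , cong (λ h → suc (δ N ⌊ a /2⌋ h)) (sym q))
... | no ¬p | no ¬q | yes w =
  contradiction (sym w) (<⇒≢ (⌊n/2⌋-mono {2 + c} (≤-trans (s≤s c<b) b<a)))
... | no ¬p | no ¬q | no _
  with δ-ultra {N} (≤∧≢⇒< (⌊n/2⌋-mono (<⇒≤ c<b)) (¬q ∘ sym))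
                   (≤∧≢⇒< (⌊n/2⌋-mono (<⇒≤ b<a)) (¬p ∘ sym)) (⌊/2⌋-<-2^ {N} a<2^N)
...   | inj₁ (lt , eq) = inj₁ (s<s lt , cong suc eq)
...   | inj₂ (lt , eq) = inj₂ (s<s lt , cong suc eq)

δs : ℕ → List ℕ → List ℕ
δs N (a ∷ b ∷ v) = δ N a b ∷ δs N (b ∷ v)
δs N (_ ∷ [])    = []
δs N []          = []

length-δs : ∀ N a v → length (δs N (a ∷ v)) ≡ length v
length-δs N a []      = refl
length-δs N a (b ∷ v) = cong suc (length-δs N b v)

drop-δs : ∀ N j v → δs N (drop j v) ≡ drop j (δs N v)
drop-δs N zero          v           = refl
drop-δs N (suc j)       []          = refl
drop-δs N (suc zero)    (a ∷ [])    = refl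
drop-δs N (suc (suc j)) (a ∷ [])    = refl
drop-δs N (suc j)       (a ∷ b ∷ v) = drop-δs N j (b ∷ v)

take-δs : ∀ N j v → δs N (take (suc j) v) ≡ take j (δs N v)
take-δs N zero    []          = refl
take-δs N (suc j) []          = refl
take-δs N zero    (a ∷ [])    = refl
take-δs N (suc j) (a ∷ [])    = refl
take-δs N zero    (a ∷ b ∷ v) = refl
take-δs N (suc j) (a ∷ b ∷ v) = cong (δ N a b ∷_) (take-δs N j (b ∷ v))

All-δs : ∀ {N v} → Below (2 ^ N) v → All (_< N) (δs N v)
All-δs []                  = []
All-δs (_ ∷ [])            = []
All-δs {N} (a< ∷ (b<a ∷ ds)) =
  δ< {N} b<a a< ∷ All-δs (<-trans b<a a< ∷ ds)

-- Only neighbouring digits must differ: the set 3, 2, 1, 0 has the sequence 0, 1, 0.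
Apart : List ℕ → Set
Apart = Linked _≢_

Apart-δs : ∀ {N v} → Below (2 ^ N) v → Apart (δs N v)
Apart-δs []             = []
Apart-δs (_ ∷ [])       = []
Apart-δs (_ ∷ (_ ∷ [])) = [-]
Apart-δs {N} {a ∷ b ∷ c ∷ v} (a< ∷ (b<a ∷ (c<b ∷ ds))) =
  apart ∷ Apart-δs (<-trans b<a a< ∷ (c<b ∷ ds))
  where
  apart : δ N a b ≢ δ N b c
  apart with δ-ultra {N} c<b b<a a<
  ... | inj₁ (lt , _) = <⇒≢ lt
  ... | inj₂ (lt , _) = <⇒≢ lt ∘ sym

-- Monotone digit sequences and the subsets realising their subsequences

Rising Falling : List ℕ → Set
Rising = AllPairs _<_
Falling = AllPairs _>_

AllPairs-∷ : ∀ {R : Rel ℕ 0ℓ} → Transitive R → ∀ {x y xs} →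
             R x y → AllPairs R (y ∷ xs) → AllPairs R (x ∷ y ∷ xs)
AllPairs-∷ trans-R xRy (ps ∷ pss) = (xRy ∷ All.map (trans-R xRy) ps) ∷ ps ∷ pss

Rising-∷ : ∀ {x y xs} → x < y → Rising (y ∷ xs) → Rising (x ∷ y ∷ xs)
Rising-∷ = AllPairs-∷ <-trans

Falling-∷ : ∀ {x y xs} → x > y → Falling (y ∷ xs) → Falling (x ∷ y ∷ xs)
Falling-∷ = AllPairs-∷ (λ p q → <-trans q p)

AllPairs-⊑ : ∀ {R : Rel ℕ 0ℓ} {xs ys} → xs ⊑ ys → AllPairs R ys → AllPairs R xs
AllPairs-⊑ []         []         = []
AllPairs-⊑ (y ∷ʳ σ)   (_ ∷ pss)  = AllPairs-⊑ σ pss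
AllPairs-⊑ (refl ∷ σ) (ps ∷ pss) = All-⊑ σ ps ∷ AllPairs-⊑ σ pss

Falling⇒Below : ∀ {N D} → All (_< N) D → Falling D → Below N D
Falling⇒Below []       []         = []
Falling⇒Below (p ∷ ps) (qs ∷ qss) = p ∷ Falling⇒Below qs qss

Rising⇒Below : ∀ {N} D → All (_< N) D → Rising D → Below N (reverse D)
Rising⇒Below     []      ps qss = []
Rising⇒Below {N} (x ∷ D) ps qss = go x D [] ps qss []
  where
  go : ∀ x D acc → All (_< N) (x ∷ D) → Rising (x ∷ D) → Below x acc →
       Below N (D ʳ++ (x ∷ acc))
  go x []      acc (p ∷ _)  _                 ds = p ∷ ds
  go x (y ∷ D) acc (_ ∷ ps) ((x<y ∷ _) ∷ qss) ds = go y D (x ∷ acc) ps qss (x<y ∷ ds)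

-- Each chosen difference is realised by the right end of its interval: in an
-- increasing δ-sequence the last difference of an interval dominates.
realise-Rising : ∀ {N a v u} → Below (2 ^ N) (a ∷ v) → Rising (δs N (a ∷ v)) →
                 u ⊑ δs N (a ∷ v) → ∃[ w ] w ⊑ v × δs N (a ∷ w) ≡ u
realise-Rising {v = []}    ds rises [] = [] , [] , refl
realise-Rising {N} {a} {b ∷ v} (a< ∷ (b<a ∷ ds)) (d< ∷ rises) (_ ∷ʳ σ)
  with realise-Rising {N} {b} {v} (<-trans b<a a< ∷ ds) rises σ
... | []    , τ , eq = [] , minimum _ , eq
... | c ∷ w , τ , refl
  with All.head (All-⊑ σ d<) | δ-ultra {N} (All.head (Below⇒All (Below-⊑ τ ds))) b<a a<
...   | δab<δbc | inj₁ (_ , eq) = c ∷ w , b ∷ʳ τ , cong (_∷ δs N (c ∷ w)) eq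
...   | δab<δbc | inj₂ (lt , _) = contradiction lt (<-asym δab<δbc)
realise-Rising {N} {a} {b ∷ v} (a< ∷ (b<a ∷ ds)) (d< ∷ rises) (refl ∷ σ)
  with realise-Rising {N} {b} {v} (<-trans b<a a< ∷ ds) rises σ
... | w , τ , refl = b ∷ w , refl ∷ τ , refl

-- By the ultrametric law, `δ N b c` is the largest of the digits between b and c.
δ<-head : ∀ {N b v d c} → Below (2 ^ N) (b ∷ v) → All (_< d) (δs N (b ∷ v)) →
          c ∈ v → δ N b c < d
δ<-head ds (p ∷ _) (here refl) = p
δ<-head {N} {b} {x ∷ v} {d} {c} (b< ∷ (x<b ∷ ds)) (p ∷ ps) (there c∈v)
  with δ<-head {N} (<-trans x<b b< ∷ ds) ps c∈v
     | δ-ultra {N} {b} {x} {c} (All.lookup (Below⇒All ds) c∈v) x<b b<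
... | q | inj₁ (_ , eq) = subst (_< d) (sym eq) q
... | q | inj₂ (_ , eq) = subst (_< d) (sym eq) p

-- In a falling sequence the first difference of an interval dominates, so a chosen difference is
-- realised by the left end of its interval, whichever element comes next.
realise-Falling : ∀ {N a v u} → Below (2 ^ N) (a ∷ v) → Falling (δs N (a ∷ v)) →
                  u ⊑ δs N (a ∷ v) → ∃[ c ] ∃[ w ] (c ∷ w) ⊑ (a ∷ v) × δs N (c ∷ w) ≡ u
realise-Falling {a = a} {[]} ds falls [] = a , [] , refl ∷ [] , refl
realise-Falling {N} {a} {b ∷ v} (a< ∷ (b<a ∷ ds)) (_ ∷ falls) (_ ∷ʳ σ)
  with realise-Falling {N} {b} {v} (<-trans b<a a< ∷ ds) falls σ
... | c , w , τ , eq = c , w , a ∷ʳ τ , eq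
realise-Falling {N} {a} {b ∷ v} (a< ∷ (b<a ∷ ds)) (>d ∷ falls) (refl ∷ σ)
  with realise-Falling {N} {b} {v} (<-trans b<a a< ∷ ds) falls σ
... | c , w , τ , refl = a , c ∷ w , refl ∷ τ ,
  cong (_∷ δs N (c ∷ w)) (first (⊑-lookup τ (here refl)))
  where
  first : c ∈ b ∷ v → δ N a c ≡ δ N a b
  first (here refl)  = refl
  first (there c∈v)
    with δ<-head {N} (<-trans b<a a< ∷ ds) >d c∈v
       | δ-ultra {N} {a} {b} {c} (All.lookup (Below⇒All ds) c∈v) b<a a<
  ... | q | inj₁ (lt , _) = contradiction lt (<-asym q)
  ... | q | inj₂ (_ , eq) = eq

-- The stepping-up colouring

Peak : List ℕ → Set
Peak (x ∷ y ∷ z ∷ _) = x < y × z < y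
Peak _               = ⊥

peakColour : List ℕ → Colour
peakColour (x ∷ y ∷ z ∷ _) with x <? y | z <? y
... | yes _ | yes _ = red
... | _     | _     = blue
peakColour _               = blue

-- φ reads descending lists, hence the reversal of rising sequences. Sequences of length at most 1
-- count as falling, whence the length hypothesis of `stepColour-Rising`.
stepColour : (List ℕ → Colour) → List ℕ → Colour
stepColour φ D with allPairs? _>?_ D | allPairs? _<?_ D
... | yes _ | _     = φ D
... | no _  | yes _ = φ (reverse D)
... | no _  | no _  = peakColour D

stepColour-Falling : ∀ φ D → Falling D → stepColour φ D ≡ φ D
stepColour-Falling φ D falls with allPairs? _>?_ D | allPairs? _<?_ D
... | yes _  | _ = refl
... | no ¬falls | _ = contradiction falls ¬falls

stepColour-Rising : ∀ φ D → 2 ≤ length D → Rising D → stepColour φ D ≡ φ (reverse D)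
stepColour-Rising φ D@(_ ∷ _ ∷ _) _ rises@((x<y ∷ _) ∷ _) with allPairs? _>?_ D | allPairs? _<?_ D
... | yes ((x>y ∷ _) ∷ _) | _ = contradiction x<y (<-asym x>y)
... | no _ | yes _   = refl
... | no _ | no ¬rises = contradiction rises ¬rises
stepColour-Rising φ (_ ∷ []) (s≤s ()) rises

peakColour-red : ∀ D → peakColour D ≡ red → Peak D
peakColour-red (x ∷ y ∷ z ∷ D) eq with x <? y | z <? y
peakColour-red (x ∷ y ∷ z ∷ D) _  | yes p | yes q = p , q
peakColour-red (x ∷ y ∷ z ∷ D) () | yes _ | no _
peakColour-red (x ∷ y ∷ z ∷ D) () | no _  | _
peakColour-red []           ()
peakColour-red (_ ∷ [])     ()
peakColour-red (_ ∷ _ ∷ []) ()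

peakColour-Peak : ∀ D → Peak D → peakColour D ≡ red
peakColour-Peak (x ∷ y ∷ z ∷ D) (p , q) with x <? y | z <? y
... | yes _ | yes _ = refl
... | yes _ | no ¬q = contradiction q ¬q
... | no ¬p | _     = contradiction p ¬p

-- What redness says about the order of the digits; the value of φ enters only through `NoMono-Run`.
Shape : List ℕ → Set
Shape W = Falling W ⊎ Rising W ⊎ Peak W

stepColour-red : ∀ φ D → stepColour φ D ≡ red → Shape D
stepColour-red φ D eq with allPairs? _>?_ D | allPairs? _<?_ D
... | yes falls | _       = inj₁ falls
... | no _    | yes rises = inj₂ (inj₁ rises)
... | no _    | no _    = inj₂ (inj₂ (peakColour-red D eq))

stepColour-blue : ∀ φ D → stepColour φ D ≡ blue → ¬ Peak D
stepColour-blue φ D@(_ ∷ _ ∷ _ ∷ _) eq (p , q) with allPairs? _>?_ D | allPairs? _<?_ D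
... | yes ((p′ ∷ _) ∷ _) | _ = <-asym p p′
... | no _ | yes (_ ∷ (q′ ∷ _) ∷ _) = <-asym q q′
... | no _ | no _ with () ← trans (sym eq) (peakColour-Peak D (p , q))

Run : ℕ → List ℕ → Set
Run m D = ∃[ j ] m ≤ length (drop j D) ×
                 (Falling (take m (drop j D)) ⊎ Rising (take m (drop j D)))

Run-∷ : ∀ {m D} x → Run m D → Run m (x ∷ D)
Run-∷ x (j , rest) = suc j , rest

length-take-≤ : ∀ {A : Set} m (xs : List A) → m ≤ length xs → length (take m xs) ≡ m
length-take-≤ m xs m≤ = trans (length-take m xs) (m≤n⇒m⊓n≡m m≤)

Windows : (List ℕ → Set) → ℕ → List ℕ → Set
Windows P k D = ∀ j → k ≤ length (drop j D) → P (take k (drop j D))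

module _ (φ : List ℕ → Colour) (k N : ℕ) (2≤k : 2 ≤ k) where

  stepped : List ℕ → Colour
  stepped v = stepColour φ (δs N v)

  -- Any k consecutive digits come from k + 1 consecutive elements of the set.
  Mono-windows : ∀ {c v} → Mono stepped (suc k) c v →
                 Windows (λ W → stepColour φ W ≡ c) k (δs N v)
  Mono-windows {c} {v} mono j k≤ =
    subst (λ D → stepColour φ D ≡ c) eq
      (mono _ (⊑-trans (take-⊑ (suc k) (drop j v)) (drop-⊑ j v)) len)
    where
    eq : δs N (take (suc k) (drop j v)) ≡ take k (drop j (δs N v))
    eq = trans (take-δs N k (drop j v)) (cong (take k) (drop-δs N j v))
    enough : ∀ w → k ≤ length (δs N w) → suc k ≤ length w
    enough []      k≤ with () ← ≤-trans 2≤k k≤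
    enough (a ∷ w) k≤ = s≤s (subst (k ≤_) (length-δs N a w) k≤)
    len : length (take (suc k) (drop j v)) ≡ suc k
    len = length-take-≤ (suc k) (drop j v)
      (enough (drop j v) (subst (k ≤_) (cong length (sym (drop-δs N j v))) k≤))

  -- Any k of the digits are the whole digit sequence of some k + 1 elements, and on falling
  -- sequences the new colour is that of φ.
  Mono-Falling : ∀ {c a v} → Below (2 ^ N) (a ∷ v) → Falling (δs N (a ∷ v)) →
             Mono stepped (suc k) c (a ∷ v) → Mono φ k c (δs N (a ∷ v))
  Mono-Falling ds falls mono u σ len with realise-Falling {N} ds falls σ
  ... | b , w , τ , refl = trans (sym (stepColour-Falling φ _ (AllPairs-⊑ σ falls)))
    (mono (b ∷ w) τ (cong suc (trans (sym (length-δs N b w)) len)))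

  Mono-Rising : ∀ {c a v} → Below (2 ^ N) (a ∷ v) → Rising (δs N (a ∷ v)) →
             Mono stepped (suc k) c (a ∷ v) → Mono φ k c (reverse (δs N (a ∷ v)))
  Mono-Rising {c} {a} {v} ds rises mono u σ len = by-realisation (realise-Rising {N} ds rises σ′)
    where
    open ≡-Reasoning
    σ′ : reverse u ⊑ δs N (a ∷ v)
    σ′ = subst (reverse u ⊑_) (reverse-involutive _) (reverse⁺ σ)
    len′ : length (reverse u) ≡ k
    len′ = trans (length-reverse u) len
    by-realisation : ∃[ w ] w ⊑ v × δs N (a ∷ w) ≡ reverse u → φ u ≡ c
    by-realisation (w , τ , eq) = begin
      φ u
        ≡⟨ cong φ (reverse-involutive u) ⟨
      φ (reverse (reverse u))
        ≡⟨ stepColour-Rising φ (reverse u) (subst (2 ≤_) (sym len′) 2≤k) (AllPairs-⊑ σ′ rises) ⟨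
      stepColour φ (reverse u)
        ≡⟨ cong (stepColour φ) eq ⟨
      stepColour φ (δs N (a ∷ w))
        ≡⟨ mono (a ∷ w) (refl ∷ τ)
             (cong suc (trans (sym (length-δs N a w)) (trans (cong length eq) len′))) ⟩
      c ∎

  -- The m + 1 elements spanning the run have m digits, and these would form a set monochromatic for
  -- φ.
  NoMono-Run : ∀ {c m v} → 1 ≤ m → NoMono φ k c m N → Below (2 ^ N) v →
               Run m (δs N v) → ¬ Mono stepped (suc k) c v
  NoMono-Run {c} {m} {v} 1≤m noMono ds (j , m≤ , shape) mono =
    absurd (take (suc m) (drop j v)) (Below-⊑ σ ds) (Mono-⊑ σ mono) eq shape
    where
    σ : take (suc m) (drop j v) ⊑ v
    σ = ⊑-trans (take-⊑ (suc m) (drop j v)) (drop-⊑ j v)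
    D : List ℕ
    D = take m (drop j (δs N v))
    eq : δs N (take (suc m) (drop j v)) ≡ D
    eq = trans (take-δs N m (drop j v)) (cong (take m) (drop-δs N j v))
    len : length D ≡ m
    len = length-take-≤ m (drop j (δs N v)) m≤
    -- The interval is generalised to `w` so that it can be split into head and tail; it is nonempty
    -- as m ≥ 1.
    absurd : ∀ w → Below (2 ^ N) w → Mono stepped (suc k) c w → δs N w ≡ D →
             Falling D ⊎ Rising D → ⊥
    absurd []      _  _    eq _
      with () ← ≤-trans 1≤m (≤-reflexive (trans (sym len) (cong length (sym eq))))
    absurd (a ∷ w) ds mono eq (inj₁ falls) = noMono (δs N (a ∷ w))
      (Falling⇒Below (All-δs ds) falls′) (≤-reflexive (trans (sym len) (cong length (sym eq))))
      (Mono-Falling ds falls′ mono)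
      where falls′ = subst Falling (sym eq) falls
    absurd (a ∷ w) ds mono eq (inj₂ rises) = noMono (reverse (δs N (a ∷ w)))
      (Rising⇒Below _ (All-δs ds) rises′)
      (≤-reflexive (trans (sym len)
        (trans (cong length (sym eq)) (sym (length-reverse (δs N (a ∷ w)))))))
      (Mono-Rising ds rises′ mono)
      where rises′ = subst Rising (sym eq) rises

-- Digit sequences of blue sets

-- A blue window excludes a peak only at its own start, so nothing is known once fewer than k terms
-- remain. This causes the slack k in the lengths below.
NoPeak : ℕ → List ℕ → Set
NoPeak k D = ∀ j → k ≤ length (drop j D) → ¬ Peak (drop j D)

NoPeak-tail : ∀ {k x D} → NoPeak k (x ∷ D) → NoPeak k D
NoPeak-tail np j = np (suc j)

-- A descent right after an ascent would be a peak.
rising : ∀ {k} m x y D → 2 ≤ k → Apart (x ∷ y ∷ D) → NoPeak k (x ∷ y ∷ D) → x < y →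
         m + k ≤ length (x ∷ y ∷ D) → Rising (take m (x ∷ y ∷ D))
rising zero          x y D 2≤k ap np x<y len = []
rising (suc zero)    x y D 2≤k ap np x<y len = [] ∷ []
rising {k} (suc (suc m)) x y [] 2≤k ap np x<y (s≤s (s≤s len))
  with () ← ≤-trans (≤-trans 2≤k (m≤n+m k m)) len
rising {k} (suc (suc m)) x y (z ∷ D) 2≤k (_ ∷ ap@(y≢z ∷ _)) np x<y (s≤s len)
  with <-cmp y z
... | tri< y<z _ _ = Rising-∷ x<y (rising (suc m) y z D 2≤k ap (NoPeak-tail np) y<z len)
... | tri≈ _ y≡z _ = contradiction y≡z y≢z
... | tri> _ _ z<y = contradiction (x<y , z<y)
  (np 0 (≤-trans (m≤n+m k (suc m)) (≤-trans len (n≤1+n _))))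

-- Follow the descents. The first ascent starts a rising run, for which m + k terms are still left;
-- if there is none in time, the first i terms fall.
falling-or-Run : ∀ {k} i m D → 2 ≤ k → Apart D → NoPeak k D → i + (m + k) ≤ length D →
                 Falling (take i D) ⊎ Run m D
falling-or-Run zero m D 2≤k ap np len = inj₁ []
falling-or-Run (suc zero) m (x ∷ D) 2≤k ap np len = inj₁ ([] ∷ [])
falling-or-Run (suc (suc i)) m (x ∷ []) 2≤k ap np (s≤s ())
falling-or-Run {k} (suc (suc i)) m D@(x ∷ y ∷ D′) 2≤k ap@(x≢y ∷ ap′) np (s≤s len)
  with <-cmp x y
... | tri≈ _ x≡y _ = contradiction x≡y x≢y
... | tri< x<y _ _ = inj₂ (0 , ≤-trans (m≤m+n m k) m+k≤ ,
                           inj₂ (rising m x y D′ 2≤k ap np x<y m+k≤))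
  where
  m+k≤ : m + k ≤ length D
  m+k≤ = ≤-trans (m≤n+m (m + k) (suc i)) (≤-trans len (n≤1+n _))
... | tri> _ _ y<x with falling-or-Run (suc i) m (y ∷ D′) 2≤k ap′ (NoPeak-tail np) len
...   | inj₁ falls = inj₁ (Falling-∷ y<x falls)
...   | inj₂ run = inj₂ (Run-∷ x run)

NoPeak⇒Run : ∀ {k} m D → 2 ≤ k → Apart D → NoPeak k D → m + (m + k) ≤ length D → Run m D
NoPeak⇒Run {k} m D 2≤k ap np len with falling-or-Run m m D 2≤k ap np len
... | inj₁ falls = 0 , ≤-trans (m≤m+n m (m + k)) len , inj₁ falls
... | inj₂ run = run

Peak-take : ∀ k D → 3 ≤ k → Peak D → Peak (take k D)
Peak-take (suc (suc (suc k))) (x ∷ y ∷ z ∷ D) _               p = p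
Peak-take (suc (suc zero))    (x ∷ y ∷ z ∷ D) (s≤s (s≤s ())) p
Peak-take (suc zero)          (x ∷ y ∷ z ∷ D) (s≤s ())       p

-- The condition under which s can be replaced by s′ in one step up.
RunForced : ℕ → ℕ → ℕ → Set
RunForced k s s′ = ∀ D → Apart D → s′ ≤ suc (length D) → Windows Shape k D → Run s D

-- Both colours reduce to a run too long for φ. In blue, 2n + k digits give a run of n terms, and
-- one more element than digits is needed.
stepUp : ∀ {k s s′ n N} → 3 ≤ k → 1 ≤ s → 1 ≤ n → RunForced k s s′ →
         Avoids k s n N → Avoids (suc k) s′ (suc (n + (n + k))) (2 ^ N)
stepUp {k} {s} {s′} {n} {N} 3≤k 1≤s 1≤n forced (φ , noRed , noBlue) =
  stepped φ k N 2≤k , noRed′ , noBlue′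
  where
  2≤k : 2 ≤ k
  2≤k = ≤-trans (n≤1+n 2) 3≤k
  length-δs′ : ∀ v → length v ≤ suc (length (δs N v))
  length-δs′ []      = z≤n
  length-δs′ (a ∷ v) = s≤s (≤-reflexive (sym (length-δs N a v)))
  noRed′ : NoMono (stepped φ k N 2≤k) (suc k) red s′ (2 ^ N)
  noRed′ v ds len mono = NoMono-Run φ k N 2≤k 1≤s noRed ds
    (forced (δs N v) (Apart-δs ds) (≤-trans len (length-δs′ v))
      λ j k≤ → stepColour-red φ _ (Mono-windows φ k N 2≤k {v = v} mono j k≤)) mono
  noBlue′ : NoMono (stepped φ k N 2≤k) (suc k) blue (suc (n + (n + k))) (2 ^ N)
  noBlue′ v ds len mono = NoMono-Run φ k N 2≤k 1≤n noBlue ds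
    (NoPeak⇒Run n (δs N v) 2≤k (Apart-δs ds)
      (λ j k≤ peak → stepColour-blue φ _ (Mono-windows φ k N 2≤k {v = v} mono j k≤)
                       (Peak-take k _ 3≤k peak))
      (≤-pred (≤-trans len (length-δs′ v)))) mono

-- Digit sequences of red sets

-- Three red-window digits can have any order but a valley. So ascents propagate to the left and
-- descents to the right, and comparing the middle two of six digits yields a run of four ending or
-- starting there.
runForced-3 : RunForced 3 4 7
runForced-3 D@(a ∷ b ∷ c ∷ d ∷ e ∷ f ∷ D′) (a≢b ∷ b≢c ∷ c≢d ∷ d≢e ∷ e≢f ∷ _) _ shape
  with <-cmp c d
... | tri≈ _ c≡d _ = contradiction c≡d c≢d
... | tri< c<d _ _ = 0 , s≤s (s≤s (s≤s (s≤s z≤n))) ,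
  inj₂ (Rising-∷ (rise a≢b b<c (shape 0 (s≤s (s≤s (s≤s z≤n)))))
         (Rising-∷ b<c (Rising-∷ c<d ([] ∷ []))))
  where
  rise : ∀ {x y z} → x ≢ y → y < z → Shape (x ∷ y ∷ z ∷ []) → x < y
  rise x≢y y<z (inj₁ (_ ∷ (z<y ∷ []) ∷ _))          = contradiction y<z (<-asym z<y)
  rise x≢y y<z (inj₂ (inj₁ ((x<y ∷ _) ∷ _)))        = x<y
  rise x≢y y<z (inj₂ (inj₂ (x<y , _)))              = x<y
  b<c = rise b≢c c<d (shape 1 (s≤s (s≤s (s≤s z≤n))))
... | tri> _ _ d<c = 2 , s≤s (s≤s (s≤s (s≤s z≤n))) ,
  inj₁ (Falling-∷ d<c (Falling-∷ e<d
         (Falling-∷ (fall d≢e e<d (shape 3 (s≤s (s≤s (s≤s z≤n))))) ([] ∷ []))))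
  where
  fall : ∀ {x y z} → x ≢ y → y < x → Shape (x ∷ y ∷ z ∷ []) → z < y
  fall x≢y y<x (inj₁ (_ ∷ (z<y ∷ []) ∷ _))          = z<y
  fall x≢y y<x (inj₂ (inj₁ ((x<y ∷ _) ∷ _)))        = contradiction y<x (<-asym x<y)
  fall x≢y y<x (inj₂ (inj₂ (x<y , _)))              = contradiction y<x (<-asym x<y)
  e<d = fall c≢d d<c (shape 2 (s≤s (s≤s (s≤s z≤n))))
runForced-3 (_ ∷ _ ∷ _ ∷ _ ∷ _ ∷ []) _ (s≤s (s≤s (s≤s (s≤s (s≤s (s≤s ())))))) _
runForced-3 (_ ∷ _ ∷ _ ∷ _ ∷ [])     _ (s≤s (s≤s (s≤s (s≤s (s≤s ()))))) _
runForced-3 (_ ∷ _ ∷ _ ∷ [])         _ (s≤s (s≤s (s≤s (s≤s ())))) _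
runForced-3 (_ ∷ _ ∷ [])             _ (s≤s (s≤s (s≤s ()))) _
runForced-3 (_ ∷ [])                 _ (s≤s (s≤s ())) _
runForced-3 []                       _ (s≤s ()) _

noValley : ∀ {x y z D} → Shape (x ∷ y ∷ z ∷ D) → ¬ (y < x × y < z)
noValley (inj₁ (_ ∷ (z<y ∷ _) ∷ _))   (_ , y<z) = <-asym z<y y<z
noValley (inj₂ (inj₁ ((x<y ∷ _) ∷ _))) (y<x , _) = <-asym x<y y<x
noValley (inj₂ (inj₂ (x<y , _)))       (y<x , _) = <-asym x<y y<x

-- This is where k ≥ 4 enters: a window of three terms cannot show a peak in third place.
noLatePeak : ∀ {x y z u D} → Shape (x ∷ y ∷ z ∷ u ∷ D) → ¬ (y < z × u < z)
noLatePeak (inj₁ (_ ∷ (z<y ∷ _) ∷ _))                 (y<z , _) = <-asym z<y y<z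
noLatePeak (inj₂ (inj₁ (_ ∷ _ ∷ (z<u ∷ _) ∷ _)))      (_ , u<z) = <-asym z<u u<z
noLatePeak (inj₂ (inj₂ (_ , z<y)))                    (y<z , _) = <-asym z<y y<z

Tail-Falling : List ℕ → Set
Tail-Falling D = Falling (drop 1 D)

-- Put x in front of y, z, u. If the terms from z on fall, an ascent from y to z makes z a late
-- peak; if y, z, u rise, a descent from x to y makes y a valley; a peak at z is a late peak.
Falling-or-Rising-∷ : ∀ {k x D} → 4 ≤ k → Apart (x ∷ D) → k ≤ length D → Shape (take k (x ∷ D)) →
                      Tail-Falling D ⊎ Rising D ⊎ Peak D → Falling D ⊎ Rising (x ∷ D)
Falling-or-Rising-∷ {suc (suc (suc (suc k)))} {x} {y ∷ z ∷ u ∷ D}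
  4≤k (_ ∷ y≢z ∷ _) _ w (inj₁ falls@((u<z ∷ _) ∷ _))
  with <-cmp y z
... | tri< y<z _ _ = contradiction (y<z , u<z) (noLatePeak w)
... | tri≈ _ y≡z _ = contradiction y≡z y≢z
... | tri> _ _ z<y = inj₁ (Falling-∷ z<y falls)
Falling-or-Rising-∷ {suc (suc (suc (suc k)))} {x} {y ∷ z ∷ u ∷ D}
  4≤k (x≢y ∷ _) _ w (inj₂ (inj₁ rises@((y<z ∷ _) ∷ _)))
  with <-cmp x y
... | tri< x<y _ _ = inj₂ (Rising-∷ x<y rises)
... | tri≈ _ x≡y _ = contradiction x≡y x≢y
... | tri> _ _ y<x = contradiction (y<x , y<z) (noValley w)
Falling-or-Rising-∷ {suc (suc (suc (suc k)))} {x} {y ∷ z ∷ u ∷ D} 4≤k _ _ w (inj₂ (inj₂ peak)) =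
  contradiction peak (noLatePeak w)
Falling-or-Rising-∷ {suc (suc (suc (suc k)))} {D = _ ∷ _ ∷ []} _ _ (s≤s (s≤s ()))
Falling-or-Rising-∷ {suc (suc (suc (suc k)))} {D = _ ∷ []}     _ _ (s≤s ())
Falling-or-Rising-∷ {suc (suc (suc zero))}  (s≤s (s≤s (s≤s ())))
Falling-or-Rising-∷ {suc (suc zero)}        (s≤s (s≤s ()))
Falling-or-Rising-∷ {suc zero}              (s≤s ())

-- Induction from the right end. The last window may itself have a peak in second place, an
-- alternative that prepending one more term removes.
windows⇒shape : ∀ {k} D → 4 ≤ k → Apart D → k ≤ length D → Windows Shape k D →
                Tail-Falling D ⊎ Rising D ⊎ Peak D
windows⇒shape {k} []      4≤k ap len w with () ← ≤-trans 4≤k len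
windows⇒shape {k} (x ∷ D) 4≤k ap len w with k ≤? length D
... | yes k≤ with Falling-or-Rising-∷ 4≤k ap k≤ (w 0 len)
                   (windows⇒shape D 4≤k (Linked.tail ap) k≤ (w ∘ suc))
...   | inj₁ falls = inj₁ falls
...   | inj₂ rises = inj₂ (inj₁ rises)
windows⇒shape {k} (x ∷ D) 4≤k ap len w | no k≰
  with subst Shape (take-all k (x ∷ D) (≰⇒> k≰)) (w 0 len)
... | inj₁ (_ ∷ falls) = inj₁ falls
... | inj₂ rest      = inj₂ rest

-- There are at least s + 1 digits, and a falling run may have to skip the first. As k ≤ s there are
-- at least two windows, which rules out the lone peak.
runForced-≥4 : ∀ {k s} → 4 ≤ k → k ≤ s → RunForced k s (2 + s)
runForced-≥4 {k} {s} 4≤k k≤s (x ∷ D) ap (s≤s (s≤s s≤)) w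
  with Falling-or-Rising-∷ 4≤k ap (≤-trans k≤s s≤) (w 0 (≤-trans k≤s (m≤n⇒m≤1+n s≤)))
        (windows⇒shape D 4≤k (Linked.tail ap) (≤-trans k≤s s≤) (w ∘ suc))
... | inj₁ falls = 1 , s≤ , inj₁ (AllPairs.take⁺ s falls)
... | inj₂ rises = 0 , m≤n⇒m≤1+n s≤ , inj₂ (AllPairs.take⁺ s rises)
runForced-≥4 4≤k k≤s [] ap (s≤s ()) w

-- The union bound

-- A subcube of the Boolean cube; `nothing` marks a free coordinate.
Pattern : ℕ → Set
Pattern = Vec (Maybe Bool)

Matches : ∀ {M} → Vec Bool M → Pattern M → Set
Matches []      []            = ⊤
Matches (b ∷ x) (nothing ∷ p) = Matches x p
Matches (b ∷ x) (just c  ∷ p) = b ≡ c × Matches x p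

-- The number of vectors that match the pattern.
weight : ∀ {M} → Pattern M → ℕ
weight []            = 1
weight (nothing ∷ p) = 2 * weight p
weight (just _  ∷ p) = weight p

weights : ∀ {M} → List (Pattern M) → ℕ
weights ps = sum (map weight ps)

restrict : ∀ {M} → Bool → List (Pattern (suc M)) → List (Pattern M)
restrict b     []                        = []
restrict b     ((nothing ∷ p) ∷ ps)      = p ∷ restrict b ps
restrict true  ((just true ∷ p) ∷ ps)    = p ∷ restrict true ps
restrict true  ((just false ∷ p) ∷ ps)   = restrict true ps
restrict false ((just true ∷ p) ∷ ps)    = restrict false ps
restrict false ((just false ∷ p) ∷ ps)   = p ∷ restrict false ps

weights-restrict : ∀ {M} (ps : List (Pattern (suc M))) →
                   weights ps ≡ weights (restrict true ps) + weights (restrict false ps)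
weights-restrict [] = refl
weights-restrict ((nothing ∷ p) ∷ ps) rewrite weights-restrict ps = lemma (weight p) _ _
  where
  lemma : ∀ w x y → 2 * w + (x + y) ≡ w + x + (w + y)
  lemma = solve-∀
weights-restrict ((just true ∷ p) ∷ ps) rewrite weights-restrict ps = sym (+-assoc (weight p) _ _)
weights-restrict ((just false ∷ p) ∷ ps) rewrite weights-restrict ps =
  lemma (weight p) (weights (restrict true ps)) _
  where
  lemma : ∀ w x y → w + (x + y) ≡ x + (w + y)
  lemma = solve-∀

restrict-∈ : ∀ {M b x p} {ps : List (Pattern (suc M))} → p ∈ ps → Matches (b ∷ x) p →
             ∃[ q ] q ∈ restrict b ps × Matches x q
restrict-∈ {p = nothing ∷ p}                  (here refl) m          = p , here refl , m
restrict-∈ {b = true}  {p = just true  ∷ p} (here refl) (refl , m) = p , here refl , m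
restrict-∈ {b = false} {p = just false ∷ p} (here refl) (refl , m) = p , here refl , m
restrict-∈ {b = b} {ps = (nothing ∷ _) ∷ _}  (there p∈) m with restrict-∈ {b = b} p∈ m
... | q , q∈ , m′ = q , there q∈ , m′
restrict-∈ {b = true}  {ps = (just true  ∷ _) ∷ _} (there p∈) m with restrict-∈ {b = true} p∈ m
... | q , q∈ , m′ = q , there q∈ , m′
restrict-∈ {b = true}  {ps = (just false ∷ _) ∷ _} (there p∈) m = restrict-∈ p∈ m
restrict-∈ {b = false} {ps = (just true  ∷ _) ∷ _} (there p∈) m = restrict-∈ p∈ m
restrict-∈ {b = false} {ps = (just false ∷ _) ∷ _} (there p∈) m with restrict-∈ {b = false} p∈ m
... | q , q∈ , m′ = q , there q∈ , m′

-- Conditional expectations: fix the coordinates one at a time, entering a half whose patterns weigh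
-- less than the half itself.
unionBound : ∀ {M} (ps : List (Pattern M)) → weights ps < 2 ^ M →
             ∃[ x ] ∀ p → p ∈ ps → ¬ Matches x p
unionBound {zero} []        _ = [] , λ _ ()
unionBound {zero} ([] ∷ ps) (s≤s ())
unionBound {suc M} ps light with weights (restrict true ps) <? 2 ^ M
... | yes lt with unionBound (restrict true ps) lt
...   | x , avoid = true ∷ x , λ p p∈ m → let q , q∈ , m′ = restrict-∈ p∈ m in avoid q q∈ m′
unionBound {suc M} ps light | no ¬lt
  with unionBound (restrict false ps) (+-cancelˡ-< (2 ^ M) _ _ (begin-strict
    2 ^ M + weights (restrict false ps)                      ≤⟨ +-monoˡ-≤ _ (≮⇒≥ ¬lt) ⟩
    weights (restrict true ps) + weights (restrict false ps) ≡⟨ weights-restrict ps ⟨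
    weights ps                                               <⟨ light ⟩
    2 * 2 ^ M                                                ≡⟨ cong (2 ^ M +_) (+-identityʳ _) ⟩
    2 ^ M + 2 ^ M                                            ∎))
  where open ≤-Reasoning
... | x , avoid = false ∷ x , λ p p∈ m → let q , q∈ , m′ = restrict-∈ p∈ m in avoid q q∈ m′

free : ∀ {M} → Pattern M
free = Vec.replicate _ nothing

weight-free : ∀ M → weight (free {M}) ≡ 2 ^ M
weight-free zero    = refl
weight-free (suc M) = cong (2 *_) (weight-free M)

weight-++ : ∀ {M L} (p : Pattern M) (q : Pattern L) → weight (p Vec.++ q) ≡ weight p * weight q
weight-++ []            q = sym (*-identityˡ _)
weight-++ (nothing ∷ p) q = trans (cong (2 *_) (weight-++ p q)) (sym (*-assoc 2 (weight p) _))
weight-++ (just _  ∷ p) q = weight-++ p q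

Matches-free : ∀ {M} (x : Vec Bool M) → Matches x free
Matches-free []      = tt
Matches-free (b ∷ x) = Matches-free x

Matches-++ : ∀ {M L} (x : Vec Bool (M + L)) (p : Pattern M) {q : Pattern L} →
             Matches (Vec.take M x) p → Matches (Vec.drop M x) q → Matches x (p Vec.++ q)
Matches-++ x       []            _         m = m
Matches-++ (b ∷ x) (nothing ∷ p) m₁        m = Matches-++ x p m₁ m
Matches-++ (b ∷ x) (just _ ∷ p)  (eq , m₁) m = eq , Matches-++ x p m₁ m

-- Random labelling of pairs

-- The binomial coefficient N choose 2, summed by rows: the row of c holds the labels of the pairs
-- (c, a) with a < c.
pairs : ℕ → ℕ
pairs zero    = 0
pairs (suc N) = N + pairs N

-- The head carries the largest index, in step with `toSubset`; `false` is a junk value outside the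
-- range.
row : ∀ {N} → Vec Bool N → ℕ → Bool
row []              a = false
row {suc N} (b ∷ x) a with a ≟ N
... | yes _ = b
... | no  _ = row x a

label : ∀ N → Vec Bool (pairs N) → ℕ → ℕ → Bool
label zero    x c a = false
label (suc N) x c a with c ≟ N
... | yes _ = row (Vec.take N x) a
... | no  _ = label N (Vec.drop N x) c a

label-top : ∀ N x a → label (suc N) x N a ≡ row (Vec.take N x) a
label-top N x a with N ≟ N
... | yes _  = refl
... | no N≢N = contradiction refl N≢N

label-below : ∀ N x {c} a → c < N → label (suc N) x c a ≡ label N (Vec.drop N x) c a
label-below N x {c} a c<N with c ≟ N
... | yes c≡N = contradiction c≡N (<⇒≢ c<N)
... | no _    = refl

-- The form of a blue set: the label of a pair depends only on its larger element.
data Stars (f : ℕ → ℕ → Bool) : List ℕ → Set where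
  []  : Stars f []
  _∷_ : ∀ {c xs} → ∃[ b ] All (λ a → f c a ≡ b) xs → Stars f xs → Stars f (c ∷ xs)

Stars-cong : ∀ {f g N xs} → (∀ {c} a → c < N → f c a ≡ g c a) → Below N xs →
             Stars f xs → Stars g xs
Stars-cong f≗g []         []              = []
Stars-cong f≗g (c< ∷ ds) ((b , eqs) ∷ st) =
  (b , All.map (trans (sym (f≗g _ c<))) eqs) ∷
  Stars-cong (λ a c′< → f≗g a (<-trans c′< c<)) ds st

toSubset : ∀ N → List ℕ → Subset N
toSubset zero    xs       = []
toSubset (suc N) []       = outside ∷ toSubset N []
toSubset (suc N) (c ∷ xs) with c ≟ N
... | yes _ = inside  ∷ toSubset N xs
... | no  _ = outside ∷ toSubset N (c ∷ xs)

toSubset-[] : ∀ N → toSubset N [] ≡ ∅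
toSubset-[] zero    = refl
toSubset-[] (suc N) = cong (outside ∷_) (toSubset-[] N)

constant : ∀ {N} → Bool → Subset N → Pattern N
constant b []            = []
constant b (inside  ∷ S) = just b  ∷ constant b S
constant b (outside ∷ S) = nothing ∷ constant b S

weight-constant : ∀ {N} b (S : Subset N) → weight (constant b S) * 2 ^ ∣ S ∣ ≡ 2 ^ N
weight-constant b []            = refl
weight-constant b (inside  ∷ S) = trans (lemma (weight (constant b S)) (2 ^ ∣ S ∣))
  (cong (2 *_) (weight-constant b S))
  where
  lemma : ∀ w p → w * (2 * p) ≡ 2 * (w * p)
  lemma = solve-∀
weight-constant b (outside ∷ S) = trans (*-assoc 2 (weight (constant b S)) _)
  (cong (2 *_) (weight-constant b S))

row-< : ∀ {N} b (x : Vec Bool N) {a} → a < N → row (b ∷ x) a ≡ row x a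
row-< {N} b x {a} a<N with a ≟ N
... | yes a≡N = contradiction a≡N (<⇒≢ a<N)
... | no _    = refl

Matches-constant : ∀ {N b} (x : Vec Bool N) {xs} → Below N xs → All (λ a → row x a ≡ b) xs →
                   Matches x (constant b (toSubset N xs))
Matches-constant []      ds eqs = tt
Matches-constant (e ∷ x) []        []         = Matches-constant x [] []
Matches-constant {suc N} (e ∷ x) {c ∷ xs} (c< ∷ ds) (eq ∷ eqs) with c ≟ N
... | yes refl = eq , Matches-constant x ds
  (All.zipWith (λ (a< , eq) → trans (sym (row-< e x a<)) eq) (Below⇒All ds , eqs))
... | no c≢N   = Matches-constant x (≤∧≢⇒< (≤-pred c<) c≢N ∷ ds) (eq ∷
  All.zipWith (λ (a< , eq) → trans (sym (row-< e x (<-trans a< (≤∧≢⇒< (≤-pred c<) c≢N)))) eq)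
    (Below⇒All ds , eqs))

extendBy : ∀ {N} → Bool → Subset N × Pattern (pairs N) → Subset (suc N) × Pattern (pairs (suc N))
extendBy b (S , p) = inside ∷ S , constant b S Vec.++ p

skip : ∀ {N} → Subset N × Pattern (pairs N) → Subset (suc N) × Pattern (pairs (suc N))
skip (S , p) = outside ∷ S , free Vec.++ p

-- One pattern for each n-set together with a bit for each of its elements. The set is carried along
-- because a new top element constrains its labels towards all of it.
starPatterns : ∀ N → ℕ → List (Subset N × Pattern (pairs N))
starPatterns N       zero    = (∅ , free) ∷ []
starPatterns zero    (suc n) = []
starPatterns (suc N) (suc n) =
  map (extendBy true) (starPatterns N n) ++ map (extendBy false) (starPatterns N n) ++
  map skip (starPatterns N (suc n))

starPatterns-complete : ∀ N n x {xs} → Below N xs → length xs ≡ n → Stars (label N x) xs →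
  ∃[ p ] (toSubset N xs , p) ∈ starPatterns N n × Matches x p
starPatterns-complete N zero x {[]} [] refl st =
  free , here (cong (_, free) (toSubset-[] N)) , Matches-free x
starPatterns-complete (suc N) (suc n) x {c ∷ xs} (c< ∷ ds) len st with c ≟ N
starPatterns-complete (suc N) (suc n) x {c ∷ xs} (c< ∷ ds) len ((b , eqs) ∷ st) | yes refl
  with starPatterns-complete N n (Vec.drop N x) ds (suc-injective len)
         (Stars-cong (label-below N x) ds st)
... | p , p∈ , m = constant b S Vec.++ p , mem b , Matches-++ x (constant b S)
  (Matches-constant (Vec.take N x) ds (All.map (trans (sym (label-top N x _))) eqs)) m
  where
  S = toSubset N xs
  mem : ∀ b → (inside ∷ S , constant b S Vec.++ p) ∈ starPatterns (suc N) (suc n)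
  mem true  = ∈-++⁺ˡ (∈-map⁺ (extendBy true) p∈)
  mem false = ∈-++⁺ʳ (map (extendBy true) (starPatterns N n)) (∈-++⁺ˡ (∈-map⁺ (extendBy false) p∈))
starPatterns-complete (suc N) (suc n) x {c ∷ xs} (c< ∷ ds) len st | no c≢N
  with starPatterns-complete N (suc n) (Vec.drop N x) ds′ len (Stars-cong (label-below N x) ds′ st)
  where
  ds′ : Below N (c ∷ xs)
  ds′ = ≤∧≢⇒< (≤-pred c<) c≢N ∷ ds
... | p , p∈ , m = free Vec.++ p ,
  ∈-++⁺ʳ (map (extendBy true) (starPatterns N n))
    (∈-++⁺ʳ (map (extendBy false) (starPatterns N n)) (∈-map⁺ skip p∈)) ,
  Matches-++ x (free {N}) (Matches-free (Vec.take N x)) m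

-- Each pattern fixes exactly the labels of the pairs inside its n-set; the product form avoids
-- subtraction in the exponent.
Exact : ∀ N → ℕ → Subset N × Pattern (pairs N) → Set
Exact N n (S , p) = ∣ S ∣ ≡ n × weight p * 2 ^ pairs n ≡ 2 ^ pairs N

extendBy-exact : ∀ {N n} b S,p → Exact N n S,p → Exact (suc N) (suc n) (extendBy b S,p)
extendBy-exact {N} {n} b (S , p) (∣S∣≡n , eq) = cong suc ∣S∣≡n , (begin
  weight (constant b S Vec.++ p) * 2 ^ (n + pairs n)
    ≡⟨ cong₂ _*_ (weight-++ (constant b S) p) (^-distribˡ-+-* 2 n (pairs n)) ⟩
  weight (constant b S) * weight p * (2 ^ n * 2 ^ pairs n)
    ≡⟨ swap (weight (constant b S)) (weight p) _ _ ⟩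
  weight (constant b S) * 2 ^ n * (weight p * 2 ^ pairs n)
    ≡⟨ cong₂ _*_ (trans (cong (λ h → weight (constant b S) * 2 ^ h) (sym ∣S∣≡n))
         (weight-constant b S)) eq ⟩
  2 ^ N * 2 ^ pairs N
    ≡⟨ ^-distribˡ-+-* 2 N (pairs N) ⟨
  2 ^ (N + pairs N) ∎)
  where
  open ≡-Reasoning
  swap : ∀ u w a b → (u * w) * (a * b) ≡ (u * a) * (w * b)
  swap = solve-∀

skip-exact : ∀ {N n} S,p → Exact N n S,p → Exact (suc N) n (skip S,p)
skip-exact {N} {n} (S , p) (∣S∣≡n , eq) = ∣S∣≡n , (begin
  weight (free {N} Vec.++ p) * 2 ^ pairs n     ≡⟨ cong (_* 2 ^ pairs n) (weight-++ (free {N}) p) ⟩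
  weight (free {N}) * weight p * 2 ^ pairs n   ≡⟨ *-assoc (weight (free {N})) (weight p) _ ⟩
  weight (free {N}) * (weight p * 2 ^ pairs n) ≡⟨ cong₂ _*_ (weight-free N) eq ⟩
  2 ^ N * 2 ^ pairs N                          ≡⟨ ^-distribˡ-+-* 2 N (pairs N) ⟨
  2 ^ (N + pairs N)                            ∎)
  where open ≡-Reasoning

starPatterns-exact : ∀ N n → All (Exact N n) (starPatterns N n)
starPatterns-exact N zero =
  (∣⊥∣≡0 N , trans (*-identityʳ _) (weight-free (pairs N))) ∷ []
starPatterns-exact zero    (suc n) = []
starPatterns-exact (suc N) (suc n) = All.++⁺ (extended true) (All.++⁺ (extended false)
  (All.map⁺ (All.map (λ {Sp} → skip-exact {N} {suc n} Sp) (starPatterns-exact N (suc n)))))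
  where
  extended : ∀ b → All (Exact (suc N) (suc n)) (map (extendBy b) (starPatterns N n))
  extended b = All.map⁺ (All.map (λ {Sp} → extendBy-exact {N} {n} b Sp) (starPatterns-exact N n))

-- Each of the n elements has at most N positions and two bits.
starPatterns-length : ∀ N n → length (starPatterns N n) ≤ (2 * N) ^ n
starPatterns-length N       zero    = ≤-refl
starPatterns-length zero    (suc n) = z≤n
starPatterns-length (suc N) (suc n) = begin
  length (map (extendBy true) P ++ map (extendBy false) P ++ map skip Q)
    ≡⟨ length-++ (map (extendBy true) P) ⟩
  length (map (extendBy true) P) + length (map (extendBy false) P ++ map skip Q)
    ≡⟨ cong₂ _+_ (length-map (extendBy true) P) (trans (length-++ (map (extendBy false) P))
         (cong₂ _+_ (length-map (extendBy false) P) (length-map skip Q))) ⟩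
  length P + (length P + length Q)
    ≤⟨ +-mono-≤ IH (+-mono-≤ IH (starPatterns-length N (suc n))) ⟩
  (2 * N) ^ n + ((2 * N) ^ n + 2 * N * (2 * N) ^ n)
    ≡⟨ lemma ((2 * N) ^ n) N ⟩
  2 * suc N * (2 * N) ^ n
    ≤⟨ *-monoʳ-≤ (2 * suc N) (^-monoˡ-≤ n (*-monoʳ-≤ 2 (n≤1+n N))) ⟩
  2 * suc N * (2 * suc N) ^ n ∎
  where
  open ≤-Reasoning
  P = starPatterns N n
  Q = starPatterns N (suc n)
  IH = starPatterns-length N n
  lemma : ∀ p N → p + (p + 2 * N * p) ≡ 2 * suc N * p
  lemma = solve-∀

weights-equal : ∀ {M} w z (ps : List (Pattern M)) → All (λ p → weight p * w ≡ z) ps →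
                weights ps * w ≡ length ps * z
weights-equal w z []       []         = refl
weights-equal w z (p ∷ ps) (eq ∷ eqs) =
  trans (*-distribʳ-+ w (weight p) (weights ps)) (cong₂ _+_ eq (weights-equal w z ps eqs))

-- Each pattern covers a fraction 1 / `2 ^ pairs n` of all labellings, so fewer than `2 ^ pairs n`
-- patterns leave one uncovered.
labelling : ∀ N n → (2 * N) ^ n < 2 ^ pairs n →
            ∃[ f ] ∀ xs → Below N xs → length xs ≡ n → ¬ Stars f xs
labelling N n few with unionBound ps light
  where
  ps = map proj₂ (starPatterns N n)
  light : weights ps < 2 ^ pairs N
  light = *-cancelʳ-< (2 ^ pairs n) _ _ (begin-strict
    weights ps * 2 ^ pairs n
      ≡⟨ weights-equal _ _ ps (All.map⁺ (All.map proj₂ (starPatterns-exact N n))) ⟩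
    length ps * 2 ^ pairs N
      ≤⟨ *-monoˡ-≤ (2 ^ pairs N) (≤-trans (≤-reflexive (length-map proj₂ (starPatterns N n)))
                                          (starPatterns-length N n)) ⟩
    (2 * N) ^ n * 2 ^ pairs N
      <⟨ *-monoˡ-< (2 ^ pairs N) {{m^n≢0 2 (pairs N)}} few ⟩
    2 ^ pairs n * 2 ^ pairs N
      ≡⟨ *-comm (2 ^ pairs n) _ ⟩
    2 ^ pairs N * 2 ^ pairs n ∎)
    where open ≤-Reasoning
... | x , avoid = label N x , λ xs ds len st →
  let p , p∈ , m = starPatterns-complete N n x ds len st in avoid p (∈-map⁺ proj₂ p∈) m

2*pairs : ∀ n → 2 * pairs n + n ≡ n * n
2*pairs zero    = refl
2*pairs (suc n) = trans (lemma n (pairs n))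
  (trans (cong (λ h → h + 2 * n + 1) (2*pairs n)) (lemma′ n))
  where
  lemma : ∀ n p → 2 * (n + p) + suc n ≡ 2 * p + n + 2 * n + 1
  lemma = solve-∀
  lemma′ : ∀ n → n * n + 2 * n + 1 ≡ suc n * suc n
  lemma′ = solve-∀

-- The exponents to compare are (m + 1)n and n(n - 1)/2, so n - 1 > 2m + 2 is required; this
-- dictates n = 2m + 4.
few-tuples : ∀ m n → n ≡ 4 + 2 * m → (2 * 2 ^ m) ^ n < 2 ^ pairs n
few-tuples m n n≡ = subst (_< 2 ^ pairs n) (sym (^-*-assoc 2 (suc m) n))
  (^-monoʳ-< 2 (s≤s (s≤s z≤n)) (≰⇒> λ le → <-irrefl refl (many le)))
  where
  open ≤-Reasoning
  lemma : ∀ m n → 2 * (suc m * n) + n ≡ (3 + 2 * m) * n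
  lemma = solve-∀
  n>0 : 0 < n
  n>0 = subst (0 <_) (sym n≡) z<s
  many : pairs n ≤ suc m * n → n * n < n * n
  many le = begin-strict
    n * n                 ≡⟨ 2*pairs n ⟨
    2 * pairs n + n       ≤⟨ +-monoˡ-≤ n (*-monoʳ-≤ 2 le) ⟩
    2 * (suc m * n) + n   ≡⟨ lemma m n ⟩
    (3 + 2 * m) * n       <⟨ *-monoˡ-< n {{>-nonZero n>0}} (≤-reflexive (sym n≡)) ⟩
    n * n                 ∎

-- The colouring of triples

starColour : (ℕ → ℕ → Bool) → List ℕ → Colour
starColour f (a ∷ b ∷ c ∷ []) with f a b Bool.≟ f a c
... | yes _ = blue
... | no  _ = red
starColour f _ = red

starColour-red : ∀ f a b c → starColour f (a ∷ b ∷ c ∷ []) ≡ red → f a b ≢ f a c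
starColour-red f a b c eq with f a b Bool.≟ f a c
starColour-red f a b c () | yes _
... | no ≢ = ≢

starColour-blue : ∀ f a b c → starColour f (a ∷ b ∷ c ∷ []) ≡ blue → f a b ≡ f a c
starColour-blue f a b c eq with f a b Bool.≟ f a c
... | yes ≡ = ≡
starColour-blue f a b c () | no _

noThreeDistinct : ∀ {x y z : Bool} → x ≢ y → x ≢ z → y ≢ z → ⊥
noThreeDistinct {true}  {true}          x≢y _ _ = x≢y refl
noThreeDistinct {false} {false}         x≢y _ _ = x≢y refl
noThreeDistinct {true}  {false} {true}  _ x≢z _ = x≢z refl
noThreeDistinct {false} {true}  {false} _ x≢z _ = x≢z refl
noThreeDistinct {true}  {false} {false} _ _ y≢z = y≢z refl
noThreeDistinct {false} {true}  {true}  _ _ y≢z = y≢z refl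

Mono-blue⇒Stars : ∀ f xs → Mono (starColour f) 3 blue xs → Stars f xs
Mono-blue⇒Stars f []           mono = []
Mono-blue⇒Stars f (c ∷ [])     mono = (true , []) ∷ []
Mono-blue⇒Stars f (c ∷ d ∷ xs) mono =
  (f c d , refl ∷ All.tabulate (λ {e} e∈ → sym (starColour-blue f c d e
    (mono (c ∷ d ∷ e ∷ []) (refl ∷ refl ∷ from∈ e∈) refl)))) ∷
  Mono-blue⇒Stars f (d ∷ xs) (Mono-⊑ (c ∷ʳ ⊑-refl) mono)

avoids-3 : ∀ m n → n ≡ 4 + 2 * m → Avoids 3 4 n (2 ^ m)
avoids-3 m n n≡ with labelling (2 ^ m) n (few-tuples m n n≡)
... | f , noStars = starColour f , noRed , noBlue
  where
  noRed : NoMono (starColour f) 3 red 4 (2 ^ m)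
  noRed (a ∷ b ∷ c ∷ d ∷ xs) _ _ mono = noThreeDistinct
    (starColour-red f a b c (mono _ (refl ∷ refl ∷ refl ∷ minimum _) refl))
    (starColour-red f a b d (mono _ (refl ∷ refl ∷ c ∷ʳ refl ∷ minimum _) refl))
    (starColour-red f a c d (mono _ (refl ∷ b ∷ʳ refl ∷ refl ∷ minimum _) refl))
  noRed (_ ∷ _ ∷ _ ∷ []) _ (s≤s (s≤s (s≤s ())))
  noRed (_ ∷ _ ∷ [])     _ (s≤s (s≤s ()))
  noRed (_ ∷ [])         _ (s≤s ())
  noBlue : NoMono (starColour f) 3 blue n (2 ^ m)
  noBlue xs ds len mono = noStars (take n xs) (Below-⊑ (take-⊑ n xs) ds)
    (length-take-≤ n xs len) (Mono-blue⇒Stars f _ (Mono-⊑ (take-⊑ n xs) mono))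

-- From lists back to subsets

elements : ∀ {M} → Subset M → List ℕ
elements []                    = []
elements {suc M} (inside  ∷ S) = M ∷ elements S
elements         (outside ∷ S) = elements S

Below-elements : ∀ {M} (S : Subset M) → Below M (elements S)
Below-elements []            = []
Below-elements (inside  ∷ S) = ≤-refl ∷ Below-elements S
Below-elements (outside ∷ S) = Below-weaken (n≤1+n _) (Below-elements S)

length-elements : ∀ {M} (S : Subset M) → length (elements S) ≡ ∣ S ∣
length-elements []            = refl
length-elements (inside  ∷ S) = cong suc (length-elements S)
length-elements (outside ∷ S) = length-elements S

⊑-elements : ∀ {M xs} (S : Subset M) → xs ⊑ elements S → ∃[ e ] e ⊆ S × elements e ≡ xs
⊑-elements []            []         = [] , (λ ()) , refl
⊑-elements (inside  ∷ S) (_ ∷ʳ σ)   with ⊑-elements S σ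
... | e , e⊆S , eq = outside ∷ e , out⊆ e⊆S , eq
⊑-elements (inside  ∷ S) (refl ∷ σ) with ⊑-elements S σ
... | e , e⊆S , eq = inside ∷ e , s⊆s e⊆S , cong (_ ∷_) eq
⊑-elements (outside ∷ S) σ          with ⊑-elements S σ
... | e , e⊆S , eq = outside ∷ e , out⊆ e⊆S , eq

Mono-elements : ∀ {k M c} f (S : Subset M) →
                Monochromatic {k} (λ (e , _) → f (elements e)) c S → Mono f k c (elements S)
Mono-elements f S mono xs σ len with ⊑-elements S σ
... | e , e⊆S , refl = mono (e , trans (sym (length-elements e)) len) e⊆S

Avoids⇒¬Arrows : ∀ {k s n M} → Avoids k s n M → ¬ Arrows k s n M
Avoids⇒¬Arrows {k} {M = M} (f , noRed , noBlue) arrows with arrows χ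
  where
  χ : Colouring k M
  χ (e , _) = f (elements e)
... | inj₁ (S , ∣S∣ , mono) = noRed (elements S) (Below-elements S)
  (≤-reflexive (sym (trans (length-elements S) ∣S∣))) (Mono-elements f S mono)
... | inj₂ (S , ∣S∣ , mono) = noBlue (elements S) (Below-elements S)
  (≤-reflexive (sym (trans (length-elements S) ∣S∣))) (Mono-elements f S mono)

Avoids-mono : ∀ {k s n n′ N N′} → n ≤ n′ → N′ ≤ N → Avoids k s n N → Avoids k s n′ N′
Avoids-mono n≤n′ N′≤N (f , noRed , noBlue) = f ,
  (λ xs ds len → noRed xs (Below-weaken N′≤N ds) len) ,
  (λ xs ds len → noBlue xs (Below-weaken N′≤N ds) (≤-trans n≤n′ len))

-- Were the Ramsey number below N, the colouring restricted to that many points would contradict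
-- `Arrows`.
Avoids⇒≤r : ∀ {k s n N} → Avoids k s n N → N ≤ r k s n
Avoids⇒≤r {k} {s} {n} {N} av = ≮⇒≥ λ r<N →
  Avoids⇒¬Arrows (Avoids-mono ≤-refl (<⇒≤ r<N) av) (proj₁ (r-isLeast k s n))

-- Towers

-- Exposes numerator and denominator, so that comparisons reduce to integers.
fromℕ-mkℚ : ∀ n → fromℕ n ≡ mkℚ (pos n) 0 (Coprime.sym (Coprime.1-coprimeTo n))
fromℕ-mkℚ n = ℚ.normalize-coprime (Coprime.sym (Coprime.1-coprimeTo n))

fromℕ-mono : ∀ {m n} → m ≤ n → fromℕ m ℚ.≤ fromℕ n
fromℕ-mono {m} {n} m≤n rewrite fromℕ-mkℚ m | fromℕ-mkℚ n =
  *≤* (ℤ.*-monoʳ-≤-nonNeg (pos 1) (ℤ.+≤+ m≤n))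

fromℕ-* : ∀ m n → fromℕ (m * n) ≡ fromℕ m ℚ.* fromℕ n
fromℕ-* m n rewrite fromℕ-mkℚ m | fromℕ-mkℚ n = cong (λ i → i ℚ./ 1) (ℤ.pos-* m n)

fromℕ-^ : ∀ m n → fromℕ (m ^ n) ≡ fromℕ m ^ℚ n
fromℕ-^ m zero    = refl
fromℕ-^ m (suc n) = trans (fromℕ-* m (m ^ n)) (cong (fromℕ m ℚ.*_) (fromℕ-^ m n))

≤fromℕ : ∀ p N → p ℚ.≤ fromℕ N → ↥ p ℤ.≤ pos (N * ↧ₙ p)
≤fromℕ p N p≤N rewrite fromℕ-mkℚ N with *≤* le ← p≤N =
  subst₂ ℤ._≤_ (ℤ.*-identityʳ (↥ p)) (sym (ℤ.pos-* N (↧ₙ p))) le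

^ℚ-nonNeg : ∀ {x} n → 0ℚ ℚ.≤ x → 0ℚ ℚ.≤ x ^ℚ n
^ℚ-nonNeg     zero    _   = fromℕ-mono {0} {1} z≤n
^ℚ-nonNeg {x} (suc n) 0≤x = ℚ.nonNegative⁻¹ (x ℚ.* x ^ℚ n)
  {{ℚ.nonNeg*nonNeg⇒nonNeg x {{ℚ.nonNegative 0≤x}} (x ^ℚ n) {{ℚ.nonNegative (^ℚ-nonNeg n 0≤x)}}}}

^ℚ-mono : ∀ {x y} n → 0ℚ ℚ.≤ x → x ℚ.≤ y → x ^ℚ n ℚ.≤ y ^ℚ n
^ℚ-mono         zero    _   _   = ℚ.≤-refl
^ℚ-mono {x} {y} (suc n) 0≤x x≤y = ℚ.≤-trans
  (ℚ.*-monoʳ-≤-nonNeg (x ^ℚ n) {{ℚ.nonNegative (^ℚ-nonNeg n 0≤x)}} x≤y)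
  (ℚ.*-monoˡ-≤-nonNeg y {{ℚ.nonNegative (ℚ.≤-trans 0≤x x≤y)}} (^ℚ-mono n 0≤x x≤y))

1^ℚ : ∀ n → 1ℚ ^ℚ n ≡ 1ℚ
1^ℚ zero    = refl
1^ℚ (suc n) = trans (ℚ.*-identityˡ _) (1^ℚ n)

2^-≤ : ∀ a m → a ℤ.≤ pos m → (2^ a) ℚ.≤ fromℕ (2 ^ m)
2^-≤ (pos a)    m (ℤ.+≤+ a≤m) =
  subst (ℚ._≤ fromℕ (2 ^ m)) (fromℕ-^ 2 a) (fromℕ-mono (^-monoʳ-≤ 2 a≤m))
2^-≤ -[1+ a ] m _           = ℚ.≤-trans
  (subst (½ ^ℚ suc a ℚ.≤_) (1^ℚ (suc a))
    (^ℚ-mono {½} {1ℚ} (suc a) (*≤* (ℤ.+≤+ z≤n)) (*≤* (ℤ.+≤+ (s≤s z≤n)))))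
  (fromℕ-mono {1} {2 ^ m} (m^n>0 2 m))

-- Let p = a / b. If q exceeded 2 to the N, its b-th power would be at least 2 to the Nb, hence at
-- least 2 to the a.
<2^⇒≤ : ∀ {q p} N → p ℚ.≤ fromℕ N → q <2^ p → q ℚ.≤ fromℕ (2 ^ N)
<2^⇒≤ N p≤N (inj₁ q<0) = ℚ.≤-trans (ℚ.<⇒≤ q<0) (fromℕ-mono {0} {2 ^ N} z≤n)
<2^⇒≤ {q} {p} N p≤N (inj₂ lt) with q ℚ.≤? fromℕ (2 ^ N)
... | yes q≤ = q≤
... | no q≰  = contradiction lt (λ lt → ℚ.<-irrefl refl (ℚ.<-≤-trans lt (begin
  2^ (↥ p)                    ≤⟨ 2^-≤ (↥ p) (N * ↧ₙ p) (≤fromℕ p N p≤N) ⟩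
  fromℕ (2 ^ (N * ↧ₙ p))      ≡⟨ cong fromℕ (^-*-assoc 2 N (↧ₙ p)) ⟨
  fromℕ ((2 ^ N) ^ ↧ₙ p)      ≡⟨ fromℕ-^ (2 ^ N) (↧ₙ p) ⟩
  fromℕ (2 ^ N) ^ℚ (↧ₙ p)     ≤⟨ ^ℚ-mono (↧ₙ p) (fromℕ-mono {0} {2 ^ N} z≤n) (ℚ.<⇒≤ (ℚ.≰⇒> q≰)) ⟩
  q ^ℚ (↧ₙ p)                 ∎)))
  where open ℚ.≤-Reasoning

-- The index is shifted: `tower i` is the tower function of height i + 1 on naturals.
tower : ℕ → ℕ → ℕ
tower zero    m = m
tower (suc i) m = 2 ^ tower i m

t≤tower : ∀ i {X} m → X ≤ᶜ m → t (suc i) X ≤ᶜ tower i m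
t≤tower zero    m X≤m = X≤m
t≤tower (suc i) m X≤m q (p , Xp , q<2^p) = <2^⇒≤ (tower i m) (t≤tower i m X≤m p Xp) q<2^p

≤ᶜ-mono : ∀ {X m n} → m ≤ n → X ≤ᶜ m → X ≤ᶜ n
≤ᶜ-mono m≤n X≤m q Xq = ℚ.≤-trans (X≤m q Xq) (fromℕ-mono m≤n)

1/-*-≤ : ∀ d n m → n ≤ suc d * m → (pos 1 ℚ./ suc d) ℚ.* fromℕ n ℚ.≤ fromℕ m
-- Unnormalised rationals are used because their products involve no gcd.
1/-*-≤ d n m n≤ = ℚ.toℚᵘ-cancel-≤ (begin
  toℚᵘ ((pos 1 ℚ./ suc d) ℚ.* fromℕ n)
    ≃⟨ ℚ.toℚᵘ-homo-* (pos 1 ℚ./ suc d) (fromℕ n) ⟩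
  toℚᵘ (pos 1 ℚ./ suc d) ℚᵘ.* toℚᵘ (fromℕ n)
    ≃⟨ ℚᵘ.*-cong (ℚ.toℚᵘ-fromℚᵘ (mkℚᵘ (pos 1) d)) (ℚ.toℚᵘ-fromℚᵘ (mkℚᵘ (pos n) 0)) ⟩
  mkℚᵘ (pos 1) d ℚᵘ.* mkℚᵘ (pos n) 0
    ≤⟨ ℚᵘ.*≤* (subst₂ ℤ._≤_ (lhs n) (rhs m) (ℤ.+≤+ n≤)) ⟩
  mkℚᵘ (pos m) 0
    ≃⟨ ℚ.toℚᵘ-fromℚᵘ (mkℚᵘ (pos m) 0) ⟨
  toℚᵘ (fromℕ m) ∎)
  where
  open ℚᵘ.≤-Reasoning
  lhs : ∀ n → pos n ≡ pos 1 ℤ.* pos n ℤ.* pos 1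
  lhs n = sym (trans (ℤ.*-identityʳ _) (ℤ.*-identityˡ (pos n)))
  rhs : ∀ m → pos (suc d * m) ≡ pos m ℤ.* pos (suc d * 1)
  rhs m = trans
    (cong pos (trans (*-comm (suc d) m) (cong (m *_) (sym (*-identityʳ (suc d))))))
    (ℤ.pos-* m (suc d * 1))

-- Iterating the step up, and the constant c

redSize : ℕ → ℕ
redSize zero    = 7
redSize (suc j) = 2 + redSize j

redSize-≥ : ∀ j → 4 + j ≤ redSize j
redSize-≥ zero    = m≤m+n 4 3
redSize-≥ (suc j) = s≤s (m≤n⇒m≤1+n (redSize-≥ j))

-- With k = 4 + j, a step sends the blue size n to 2n + k + 1, so it stays linear in m + 1: a factor
-- D becomes 2D + k + 1. The start needs 4m + 12, which is at most 12(m + 1).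
avoids : ∀ j → ∃[ d ] ∀ m n → suc d * suc m ≤ n → Avoids (4 + j) (redSize j) n (tower (2 + j) m)
avoids zero = 11 , λ m n len →
  Avoids-mono (≤-trans (m≤m+n _ (8 * m)) (≤-trans (≤-reflexive (lemma m)) len)) ≤-refl
    (stepUp ≤-refl (s≤s z≤n) (s≤s z≤n) runForced-3 (avoids-3 m (4 + 2 * m) refl))
  where
  lemma : ∀ m → suc (4 + 2 * m + (4 + 2 * m + 3)) + 8 * m ≡ 12 * suc m
  lemma = solve-∀
avoids (suc j) with avoids j
... | d , av = 2 * d + (6 + j) , λ m n len →
  Avoids-mono (≤-trans (m≤m+n _ ((5 + j) * m)) (≤-trans (≤-reflexive (lemma d j m)) len)) ≤-refl
    (stepUp (m≤n⇒m≤1+n (s≤s (s≤s (s≤s z≤n)))) (≤-trans (s≤s z≤n) (redSize-≥ j)) (s≤s z≤n)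
      (runForced-≥4 (m≤m+n 4 j) (redSize-≥ j)) (av m (suc d * suc m) ≤-refl))
  where
  lemma : ∀ d j m → suc (suc d * suc m + (suc d * suc m + (4 + j))) + (5 + j) * m
                  ≡ suc (2 * d + (6 + j)) * suc m
  lemma = solve-∀

-- The witness is m = ⌊n/(d+1)⌋ - 1.
scale : ∀ d n → 2 * suc d ≤ n → ∃[ m ] suc d * suc m ≤ n × n ≤ 3 * suc d * m
scale d n 2D≤n with n / suc d | m≡m%n+[m/n]*n n (suc d) | m%n<n n (suc d)
    | subst (_≤ n / suc d) (m*n/n≡m 2 (suc d)) (/-monoˡ-≤ (suc d) 2D≤n)
-- The quotient q is at least 2, so q + 1 is at most 3(q - 1); this gives the factor 3.
... | suc (suc m) | n≡ | rem< | _ = suc m ,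
  ≤-trans (≤-reflexive (*-comm (suc d) (2 + m))) (≤-trans (m≤n+m _ _) (≤-reflexive (sym n≡))) ,
  (begin
    n                                        ≡⟨ n≡ ⟩
    n % suc d + (2 + m) * suc d              ≤⟨ +-monoˡ-≤ _ (<⇒≤ rem<) ⟩
    suc d + (2 + m) * suc d                  ≤⟨ m≤m+n _ (2 * suc d * m) ⟩
    suc d + (2 + m) * suc d + 2 * suc d * m  ≡⟨ lemma d m ⟩
    3 * suc d * suc m                        ∎)
  where
  open ≤-Reasoning
  lemma : ∀ d m → suc d + (2 + m) * suc d + 2 * suc d * m ≡ 3 * suc d * suc m
  lemma = solve-∀
... | suc zero | _ | _ | s≤s ()

towerGrowth : ∀ j → TowerGrowth (4 + j) (redSize j)
towerGrowth j with avoids j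
... | d , av = c , ℚ.positive⁻¹ c {{ℚ.normalize-pos 1 (3 * suc d)}} , 2 * suc d , growth
  where
  c : ℚ
  -- Chosen so that cn is at most the m supplied by `scale`.
  c = pos 1 ℚ./ (3 * suc d)
  growth : ∀ n → 2 * suc d ≤ n → t (3 + j) ⟦ c ℚ.* fromℕ n ⟧ ≤ᶜ r (4 + j) (redSize j) n
  growth n n≥ with scale d n n≥
  ... | m , ≤n , n≤ = ≤ᶜ-mono (Avoids⇒≤r (av m n ≤n)) (t≤tower (2 + j) m
    λ q q< → ℚ.≤-trans (ℚ.<⇒≤ q<) (1/-*-≤ (pred (3 * suc d)) n m n≤))

-- With k = 4 + j, `redSize j` is 2k - 1 = (2k + 2) - 3, and twice 2k + 2 is at most 5k since k ≥ 4.
redSize-≤ : ∀ j → redSize j ≤ ⌈ 5 * (4 + j) /2⌉ ∸ 3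
redSize-≤ j = begin
  redSize j                          ≡⟨ redSize-≡ j ⟩
  (10 + 2 * j) ∸ 3                   ≡⟨ cong (_∸ 3) (n≡⌈n+n/2⌉ (10 + 2 * j)) ⟩
  ⌈ 10 + 2 * j + (10 + 2 * j) /2⌉ ∸ 3 ≤⟨ ∸-monoˡ-≤ 3 (⌈n/2⌉-mono
    (≤-trans (m≤m+n _ j) (≤-reflexive (lemma j)))) ⟩
  ⌈ 5 * (4 + j) /2⌉ ∸ 3              ∎
  where
  open ≤-Reasoning
  redSize-≡ : ∀ j → redSize j ≡ 7 + 2 * j
  redSize-≡ zero    = refl
  redSize-≡ (suc j) = trans (cong (λ h → 2 + h) (redSize-≡ j)) (lemma₂ j)
    where
    lemma₂ : ∀ j → 2 + (7 + 2 * j) ≡ 7 + 2 * suc j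
    lemma₂ = solve-∀
  lemma : ∀ j → 10 + 2 * j + (10 + 2 * j) + j ≡ 5 * (4 + j)
  lemma = solve-∀

-- The explicit s of tower growth shows, by `¬¬least`, that the bound on all solutions of `Is-s` is
-- not vacuous.
mainTheorem5 : ∀ (k : ℕ) → 4 ≤ k →
    (∃[ s ] (TowerGrowth k s × s ≤ ⌈ 5 * k /2⌉ ∸ 3)) ×
    (∀ (s : ℕ) → Is-s k s → s ≤ ⌈ 5 * k /2⌉ ∸ 3)
mainTheorem5 (suc (suc (suc (suc j)))) _ =
  (redSize j , towerGrowth j , redSize-≤ j) ,
  λ s (_ , s≤) → ≤-trans (s≤ (redSize j) (towerGrowth j)) (redSize-≤ j)
mainTheorem5 (suc (suc (suc zero))) (s≤s (s≤s (s≤s ())))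
mainTheorem5 (suc (suc zero))       (s≤s (s≤s ()))
mainTheorem5 (suc zero)             (s≤s ())
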